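{- For every integer $n\geq 0$, \[ \overline{C}(0,3,3n+2)=\overline{C}(1,3,3n+2)=\overline{C}(2,3,3n+2)=\frac{\overline{a}(3n+2)}{3}\equiv 0\pmod 2 . \]
   Context: An overpartition is a partition in which the first occurrence of each distinct part size may be overlined. An overcubic partition of $n$ is a pair $(\pi_r,\pi_b)$ of overpartitions with $|\pi_r|+|\pi_b|=n$ ($|\pi|$ the sum of parts) such that every part of $\pi_b$ is even; their number $\overline{a}(n)$ satisfies $\sum_{n\ge0}\overline{a}(n)q^n=\frac{(-q;q)_\infty(-q^2;q^2)_\infty}{(q;q)_\infty(q^2;q^2)_\infty}$, where $(a;q)_\infty=\prod_{k\ge0}(1-aq^k)$. For an overpartition $\pi$ let $\ell(\pi)$ be its number of parts (overlined and non-overlined both counted), and let $\pi_r^e$ be the overpartition formed by the even parts of $\pi_r$. The crank of $(\pi_r,\pi_b)$ is $r_c=\ell(\pi_r^e)-\ell(\pi_b)$. Let $\overline{C}(i,3,n)$ be the number of overcubic partitions of $n$ with $r_c\equiv i\pmod 3$. -}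

module Defs where

open import Data.Nat using (ℕ; zero; suc; _+_; _*_; _∸_; _<ᵇ_; _≡ᵇ_; _%_)
open import Data.Bool using (Bool; true; false; _∧_; not; if_then_else_)
open import Data.Product using (_×_; _,_; proj₁; proj₂)
open import Data.List using (List; []; _∷_; [_]; map; concatMap; upTo; filterᵇ; length)
open import Data.Nat.ListAction using (sum)
open import Data.Bool.ListAction using (all)
open import Data.Integer using (ℤ; +_; _-_; _%ℕ_)

-- A (flagged) list of parts: each entry is (part size , overlined?).
FlaggedList : Set
FlaggedList = List (ℕ × Bool)

size : FlaggedList → ℕ
size π = sum (map proj₁ π)

len : FlaggedList → ℕ
len = length

-- Canonical form of an overpartition: parts listed in non-increasing order,
-- all parts positive; among equal parts at most one is overlined, and it is
-- listed first (the overline sits on the first occurrence of that size).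
-- validᵇ checks that every part is ≥ 1 and every consecutive pair
-- (a , b₁) (c , b₂) has  c < a,  or  c = a and b₂ = false.
pairOK : ℕ × Bool → ℕ × Bool → Bool
pairOK (a , _) (c , b₂) = (c <ᵇ a) Data.Bool.∨ ((c ≡ᵇ a) ∧ not b₂)

positive : ℕ × Bool → Bool
positive (a , _) = 0 <ᵇ a

sortedOK : FlaggedList → Bool
sortedOK [] = true
sortedOK (x ∷ []) = true
sortedOK (x ∷ y ∷ π) = pairOK x y ∧ sortedOK (y ∷ π)

isOverpartition : FlaggedList → Bool
isOverpartition π = all positive π ∧ sortedOK π

-- All flagged lists of positive parts summing to m (ordered, every flag),
-- with a fuel argument (fuel ≥ m suffices).
flaggedComps : (fuel m : ℕ) → List FlaggedList
flaggedComps _ zero = [ [] ]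
flaggedComps zero (suc m) = []
flaggedComps (suc f) (suc m) =
  concatMap (λ k → concatMap (λ b → map ((suc k , b) ∷_) (flaggedComps f (m ∸ k)))
                               (true ∷ false ∷ []))
            (upTo (suc m))

overpartitions : ℕ → List FlaggedList
overpartitions m = filterᵇ isOverpartition (flaggedComps m m)

even : ℕ → Bool
even k = k % 2 ≡ᵇ 0

allEven : FlaggedList → Bool
allEven π = all (λ p → even (proj₁ p)) π

overcubic : ℕ → List (FlaggedList × FlaggedList)
overcubic n =
  concatMap (λ j → concatMap (λ πb → map (λ πr → (πr , πb)) (overpartitions (n ∸ j)))
                              (filterᵇ allEven (overpartitions j)))
            (upTo (suc n))

abar : ℕ → ℕ
abar n = length (overcubic n)

evenParts : FlaggedList → FlaggedList
evenParts = filterᵇ (λ p → even (proj₁ p))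

crank : FlaggedList × FlaggedList → ℤ
crank (πr , πb) = + len (evenParts πr) - + len πb

-- C̄(i, m, n): number of overcubic partitions of n with r_c ≡ i (mod m)
-- (residue of the integer crank taken in {0,…,m-1}); modulus m = suc m'.
Cbar : (i m' n : ℕ) → ℕ
Cbar i m' n = length (filterᵇ (λ p → (crank p %ℕ suc m') ≡ᵇ i) (overcubic n))

{-# OPTIONS --safe #-}
-- At a primitive cube root of unity ω, the crank generating function is
-- ∏_{c odd} (1 + q^c)/(1 - q^c) · ∏_{c even} (1 + ωq^c)(1 + ω²q^c)/((1 - ωq^c)(1 - ω²q^c)).
-- Since (1 - x)(1 - ωx)(1 - ω²x) = 1 - x³, it equals a series in q³ times
-- ∏_c (1 - (-q)^c)/(1 + (-q)^c), which is ∑_s q^{s²} by Gauss. No square is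
-- 2 mod 3, so every coefficient of q^{3n+2} vanishes in ℤ[ω], that is, the three
-- residue classes of the crank are equinumerous. Every factor (1 + x)/(1 - x) is
-- 1 mod 2, so the number of overcubic partitions is even as well.
--
-- All products are truncated to c ≤ N, and coefficients are compared up to q^N.
module Submission where

-- No series is inverted. Product identities are stated with denominators multiplied out, and a
-- factor is removed only where the vanishing of coefficients on a set of exponents survives its
-- removal. This depends on the set: cancelling 1 + aX^d refers back to earlier coefficients in
-- steps of d. The factors in q³ can therefore be cancelled on the class 2 mod 3, while the factors
-- of (-q;q)_n mix the residues and are cancelled on the initial segment of exponents up to n. Hence
-- the crank series, cleared of its cubic denominators, is first compared with the theta sum on that
-- whole segment, and residues mod 3 enter only afterwards. Truncation is harmless because Shanks'
-- finite form of Gauss's identity has an error divisible by q^{n+1}. One equation in ℤ[ω] yields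
-- both equalities of counts, since its two coordinates vanish separately. Parity comes from the
-- same enumeration with all crank weights set to 1 over ℤ, and passes from the total to each third
-- because 3 is odd.

open import Defs
open import Algebra.Bundles using (CommutativeRing; RawRing)
open import Algebra.Solver.Ring.AlmostCommutativeRing using (fromCommutativeRing; _-Raw-AlmostCommutative⟶_)
open import Data.Bool using (Bool; true; false; _∧_; if_then_else_)
open import Data.Bool.ListAction using (all)
open import Data.Bool.Properties using (∧-zeroʳ)
open import Data.List using (List; []; _∷_; _++_; map; concatMap; applyUpTo; upTo; filterᵇ; length)
open import Data.List.Properties using (concatMap-cong)
open import Data.Maybe.Base using (Maybe; just; nothing)
open import Data.Nat as ℕ using (ℕ; zero; suc; _≤_; _<_; z≤n; s≤s; _∸_; _≡ᵇ_; _<ᵇ_; _%_)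
open import Data.Nat.DivMod using (m%n<n; %-distribˡ-*; [m+kn]%n≡m%n; m*n/n≡m)
open import Data.Nat.Divisibility using (_∣_; divides; ∣m+n∣m⇒∣n)
open import Data.Nat.Induction using (<-rec)
open import Data.Product using (_×_; _,_; proj₁; proj₂; ∃-syntax)
open import Data.Sum using (_⊎_; inj₁; inj₂)
open import Function using (_∘_)
open import Level using (Level; 0ℓ)
open import Relation.Binary.PropositionalEquality as ≡ using (_≡_)
open import Relation.Nullary using (yes; no; ¬_; contradiction)
import Algebra.Properties.AbelianGroup
import Algebra.Properties.CommutativeSemigroup
import Algebra.Properties.CommutativeSemiring.Exp
import Algebra.Properties.Ring
import Algebra.Properties.Semiring.Mult.TCOptimised
import Algebra.Solver.Ring
import Data.Nat.Properties as ℕ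
import Relation.Binary.Reasoning.Setoid

-- A ring solver with integer coefficients for any commutative ring.

-- The coefficient (a , b), with a or b zero, stands for the integer a - b;
-- the clause for b = 0 makes the constants 0 and 1 denote 0# and 1# definitionally.
module CommutativeRingSolver {c ℓ : Level} (R : CommutativeRing c ℓ) where
  open CommutativeRing R
  open Algebra.Properties.Ring ring using (-‿distribˡ-*; -‿distribʳ-*; -0#≈0#)
  open Algebra.Properties.AbelianGroup +-abelianGroup using (⁻¹-∙-comm; ⁻¹-anti-homo‿-)
  open Algebra.Properties.CommutativeSemigroup +-commutativeSemigroup using (interchange)
  open Algebra.Properties.Semiring.Mult.TCOptimised semiring using (×-homo-+; ×1-homo-*) renaming (_×_ to _⊠_)
  open Relation.Binary.Reasoning.Setoid setoid

  private
    -- Truncated subtraction both ways leaves at least one component zero, so each integer has one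
    -- normal form while the arithmetic stays in ℕ.
    reduce : ℕ → ℕ → ℕ × ℕ
    reduce a b = a ℕ.∸ b , b ℕ.∸ a

    ∸+≡+∸ : ∀ a b → a ℕ.∸ b ℕ.+ b ≡ a ℕ.+ (b ℕ.∸ a)
    ∸+≡+∸ zero    zero    = ≡.refl
    ∸+≡+∸ zero    (suc b) = ≡.refl
    ∸+≡+∸ (suc a) zero    = ≡.refl
    ∸+≡+∸ (suc a) (suc b) = ≡.trans (ℕ.+-suc (a ℕ.∸ b) b) (≡.cong suc (∸+≡+∸ a b))

    differences : RawRing _ _
    differences = record
      { Carrier = ℕ × ℕ
      ; _≈_     = _≡_
      ; _+_     = λ (a , b) (a′ , b′) → reduce (a ℕ.+ a′) (b ℕ.+ b′)
      ; _*_     = λ (a , b) (a′ , b′) → reduce (a ℕ.* a′ ℕ.+ b ℕ.* b′) (a ℕ.* b′ ℕ.+ b ℕ.* a′)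
      ; -_      = λ (a , b) → b , a
      ; 0#      = 0 , 0
      ; 1#      = 1 , 0
      }

    ⟪_⟫ : ℕ → Carrier
    ⟪ n ⟫ = n ⊠ 1#

    ⟦_⟧ᵈ : ℕ × ℕ → Carrier
    ⟦ a , zero ⟧ᵈ  = ⟪ a ⟫
    ⟦ a , suc b ⟧ᵈ = ⟪ a ⟫ - ⟪ suc b ⟫

    ⟦⟧ᵈ-minus : ∀ a b → ⟦ a , b ⟧ᵈ ≈ ⟪ a ⟫ - ⟪ b ⟫
    ⟦⟧ᵈ-minus a zero    = sym (trans (+-congˡ -0#≈0#) (+-identityʳ _))
    ⟦⟧ᵈ-minus a (suc b) = refl

    minus-+-minus : ∀ a b a′ b′ → (a - b) + (a′ - b′) ≈ (a + a′) - (b + b′)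
    minus-+-minus a b a′ b′ = trans (interchange _ _ _ _) (+-congˡ (⁻¹-∙-comm b b′))

    minus-*-minus : ∀ a b a′ b′ → (a - b) * (a′ - b′) ≈ (a * a′ + b * b′) - (a * b′ + b * a′)
    minus-*-minus a b a′ b′ = begin
      (a - b) * (a′ - b′)
        ≈⟨ distribʳ _ _ _ ⟩
      a * (a′ - b′) + (- b) * (a′ - b′)
        ≈⟨ +-cong (trans (distribˡ _ _ _) (+-congˡ (sym (-‿distribʳ-* _ _)))) (sym (-‿distribˡ-* _ _)) ⟩
      (a * a′ - a * b′) + - (b * (a′ - b′))
        ≈⟨ +-congˡ (-‿cong (trans (distribˡ _ _ _) (+-congˡ (sym (-‿distribʳ-* _ _))))) ⟩
      (a * a′ - a * b′) + - (b * a′ - b * b′)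
        ≈⟨ +-congˡ (⁻¹-anti-homo‿- _ _) ⟩
      (a * a′ - a * b′) + (b * b′ - b * a′)
        ≈⟨ minus-+-minus _ _ _ _ ⟩
      (a * a′ + b * b′) - (a * b′ + b * a′) ∎

    minus-cong : ∀ {a a′ b b′} → a ≈ a′ → b ≈ b′ → a - b ≈ a′ - b′
    minus-cong p q = +-cong p (-‿cong q)

    sum-of-products : ∀ a a′ b b′ → ⟪ a ℕ.* a′ ℕ.+ b ℕ.* b′ ⟫ ≈ ⟪ a ⟫ * ⟪ a′ ⟫ + ⟪ b ⟫ * ⟪ b′ ⟫
    sum-of-products a a′ b b′ =
      trans (×-homo-+ 1# (a ℕ.* a′) (b ℕ.* b′)) (+-cong (×1-homo-* a a′) (×1-homo-* b b′))

    -- Padding both differences to the common subtrahend `b + b′` reduces their equality to one in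
    -- ℕ, which is decidable whatever the ring.
    cross-sum⇒≈ : ∀ a b a′ b′ → a ℕ.+ b′ ≡ a′ ℕ.+ b → ⟦ a , b ⟧ᵈ ≈ ⟦ a′ , b′ ⟧ᵈ
    cross-sum⇒≈ a b a′ b′ eq = begin
      ⟦ a , b ⟧ᵈ
        ≈⟨ ⟦⟧ᵈ-minus a b ⟩
      ⟪ a ⟫ - ⟪ b ⟫
        ≈⟨ pad ⟪ a ⟫ ⟪ b ⟫ ⟪ b′ ⟫ ⟩
      (⟪ a ⟫ + ⟪ b′ ⟫) - (⟪ b ⟫ + ⟪ b′ ⟫)
        ≈⟨ minus-cong (trans (sym (×-homo-+ 1# a b′)) (trans (reflexive (≡.cong ⟪_⟫ eq)) (×-homo-+ 1# a′ b))) (+-comm _ _) ⟩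
      (⟪ a′ ⟫ + ⟪ b ⟫) - (⟪ b′ ⟫ + ⟪ b ⟫)
        ≈⟨ pad ⟪ a′ ⟫ ⟪ b′ ⟫ ⟪ b ⟫ ⟨
      ⟪ a′ ⟫ - ⟪ b′ ⟫
        ≈⟨ ⟦⟧ᵈ-minus a′ b′ ⟨
      ⟦ a′ , b′ ⟧ᵈ ∎
      where
      pad : ∀ x y z → x - y ≈ (x + z) - (y + z)
      pad x y z = begin
        x - y              ≈⟨ +-identityʳ _ ⟨
        x - y + 0#         ≈⟨ +-congˡ (-‿inverseʳ z) ⟨
        (x - y) + (z - z)  ≈⟨ minus-+-minus _ _ _ _ ⟩
        (x + z) - (y + z)  ∎

    reduce-≈ : ∀ a b → ⟦ reduce a b ⟧ᵈ ≈ ⟪ a ⟫ - ⟪ b ⟫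
    reduce-≈ a b = trans (cross-sum⇒≈ _ _ a b (∸+≡+∸ a b)) (⟦⟧ᵈ-minus a b)

    homomorphism : differences -Raw-AlmostCommutative⟶ fromCommutativeRing R
    homomorphism = record
      { ⟦_⟧    = ⟦_⟧ᵈ
      ; +-homo = λ (a , b) (a′ , b′) → begin
          ⟦ reduce (a ℕ.+ a′) (b ℕ.+ b′) ⟧ᵈ
            ≈⟨ reduce-≈ (a ℕ.+ a′) (b ℕ.+ b′) ⟩
          ⟪ a ℕ.+ a′ ⟫ - ⟪ b ℕ.+ b′ ⟫
            ≈⟨ minus-cong (×-homo-+ 1# a a′) (×-homo-+ 1# b b′) ⟩
          (⟪ a ⟫ + ⟪ a′ ⟫) - (⟪ b ⟫ + ⟪ b′ ⟫)
            ≈⟨ minus-+-minus _ _ _ _ ⟨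
          (⟪ a ⟫ - ⟪ b ⟫) + (⟪ a′ ⟫ - ⟪ b′ ⟫)
            ≈⟨ +-cong (⟦⟧ᵈ-minus a b) (⟦⟧ᵈ-minus a′ b′) ⟨
          ⟦ a , b ⟧ᵈ + ⟦ a′ , b′ ⟧ᵈ ∎
      ; *-homo = λ (a , b) (a′ , b′) → begin
          ⟦ reduce (a ℕ.* a′ ℕ.+ b ℕ.* b′) (a ℕ.* b′ ℕ.+ b ℕ.* a′) ⟧ᵈ
            ≈⟨ reduce-≈ (a ℕ.* a′ ℕ.+ b ℕ.* b′) (a ℕ.* b′ ℕ.+ b ℕ.* a′) ⟩
          ⟪ a ℕ.* a′ ℕ.+ b ℕ.* b′ ⟫ - ⟪ a ℕ.* b′ ℕ.+ b ℕ.* a′ ⟫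
            ≈⟨ minus-cong (sum-of-products a a′ b b′) (sum-of-products a b′ b a′) ⟩
          (⟪ a ⟫ * ⟪ a′ ⟫ + ⟪ b ⟫ * ⟪ b′ ⟫) - (⟪ a ⟫ * ⟪ b′ ⟫ + ⟪ b ⟫ * ⟪ a′ ⟫)
            ≈⟨ minus-*-minus _ _ _ _ ⟨
          (⟪ a ⟫ - ⟪ b ⟫) * (⟪ a′ ⟫ - ⟪ b′ ⟫)
            ≈⟨ *-cong (⟦⟧ᵈ-minus a b) (⟦⟧ᵈ-minus a′ b′) ⟨
          ⟦ a , b ⟧ᵈ * ⟦ a′ , b′ ⟧ᵈ ∎
      ; -‿homo = λ (a , b) → begin
          ⟦ b , a ⟧ᵈ          ≈⟨ ⟦⟧ᵈ-minus b a ⟩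
          ⟪ b ⟫ - ⟪ a ⟫       ≈⟨ ⁻¹-anti-homo‿- _ _ ⟨
          - (⟪ a ⟫ - ⟪ b ⟫)   ≈⟨ -‿cong (⟦⟧ᵈ-minus a b) ⟨
          - ⟦ a , b ⟧ᵈ        ∎
      ; 0-homo = refl
      ; 1-homo = refl
      }

    coefficients≟ : ∀ p q → Maybe (⟦ p ⟧ᵈ ≈ ⟦ q ⟧ᵈ)
    coefficients≟ (a , b) (a′ , b′) with a ℕ.+ b′ ℕ.≟ a′ ℕ.+ b
    ... | yes eq = just (cross-sum⇒≈ a b a′ b′ eq)
    ... | no  _  = nothing

  open Algebra.Solver.Ring differences (fromCommutativeRing R) homomorphism coefficients≟ public
    using (Polynomial; solve; _:=_; _:+_; _:*_; _:-_; :-_; con)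

  :0 :1 : ∀ {n} → Polynomial n
  :0 = con (0 , 0)
  :1 = con (1 , 0)

-- Gauss's theta identity in Shanks' finite form.

module GaussIdentity {c ℓ : Level} (S : CommutativeRing c ℓ) (q : CommutativeRing.Carrier S) where
  open CommutativeRing S
  open CommutativeRingSolver S
  open Algebra.Properties.CommutativeSemiring.Exp commutativeSemiring using (_^_; ^-congˡ; ^-distrib-*)
  open Relation.Binary.Reasoning.Setoid setoid

  -- The q-Pochhammer symbols (q;q)_n and (-q;q)_n.
  poch⁻ poch⁺ : ℕ → Carrier
  poch⁻ zero    = 1#
  poch⁻ (suc n) = (1# - q ^ suc n) * poch⁻ n
  poch⁺ zero    = 1#
  poch⁺ (suc n) = (1# + q ^ suc n) * poch⁺ n

  -- The sum of (-1)^s q^{s²} over all integers s with |s| ≤ n: the outer power supplies sign and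
  -- square at once, and the factor 2 pairs s with -s.
  θ : ℕ → Carrier
  θ zero    = 1#
  θ (suc n) = θ n + (1# + 1#) * (- (q ^ suc n)) ^ suc n

  -- shanks n z = ∑_{s ≤ n} (-1;q)_s (q^{s+1};q)_{n-s} (-z)^s, using (-1;q)_{s+1} = 2 (-q;q)_s.
  shanks : ℕ → Carrier → Carrier
  shanks zero    z = 1#
  shanks (suc n) z = (1# - q ^ suc n) * shanks n z + (1# + 1#) * poch⁺ n * (- z) ^ suc n

  private
    [-qz]^ : ∀ z n → (- (q * z)) ^ n ≈ q ^ n * (- z) ^ n
    [-qz]^ z n = trans (^-congˡ n (solve 2 (λ q z → :- (q :* z) := q :* (:- z)) refl q z)) (^-distrib-* q (- z) n)

  -- Divided by (q;q)_n, the sum is a partial sum of the q-binomial series F(z) = (z;q)_∞ /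
  -- (-z;q)_∞, for which (1 - z) F(qz) = (1 + z) F(z). Truncation costs exactly the summand that
  -- `shanks (suc n) z` would append.
  shanks-functional : ∀ n z → (1# - z) * shanks n (q * z) ≈ (1# + z) * shanks n z + (1# + 1#) * poch⁺ n * (- z) ^ suc n
  shanks-functional zero z =
    solve 1 (λ z → (:1 :- z) :* :1 := (:1 :+ z) :* :1 :+ (:1 :+ :1) :* :1 :* ((:- z) :* :1)) refl z
  shanks-functional (suc n) z = begin
    (1# - z) * ((1# - Q) * A′ + (1# + 1#) * P * (- (q * z)) ^ suc n)
      ≈⟨ *-congˡ (+-congˡ (*-congˡ ([-qz]^ z (suc n)))) ⟩
    (1# - z) * ((1# - Q) * A′ + (1# + 1#) * P * (Q * Y))
      ≈⟨ solve 5 (λ z Q A′ P Y →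
           (:1 :- z) :* ((:1 :- Q) :* A′ :+ (:1 :+ :1) :* P :* (Q :* Y)) :=
           (:1 :- Q) :* ((:1 :- z) :* A′) :+ (:1 :- z) :* ((:1 :+ :1) :* P :* (Q :* Y))) refl z Q A′ P Y ⟩
    (1# - Q) * ((1# - z) * A′) + (1# - z) * ((1# + 1#) * P * (Q * Y))
      ≈⟨ +-congʳ (*-congˡ (shanks-functional n z)) ⟩
    (1# - Q) * ((1# + z) * A + (1# + 1#) * P * Y) + (1# - z) * ((1# + 1#) * P * (Q * Y))
      ≈⟨ solve 5 (λ z Q A P Y →
           (:1 :- Q) :* ((:1 :+ z) :* A :+ (:1 :+ :1) :* P :* Y) :+ (:1 :- z) :* ((:1 :+ :1) :* P :* (Q :* Y)) :=
           (:1 :+ z) :* ((:1 :- Q) :* A :+ (:1 :+ :1) :* P :* Y)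
             :+ (:1 :+ :1) :* ((:1 :+ Q) :* P) :* ((:- z) :* Y)) refl z Q A P Y ⟩
    (1# + z) * ((1# - Q) * A + (1# + 1#) * P * Y) + (1# + 1#) * ((1# + Q) * P) * ((- z) * Y) ∎
    where
    Q  = q ^ suc n
    A  = shanks n z
    A′ = shanks n (q * z)
    P  = poch⁺ n
    Y  = (- z) ^ suc n

  -- In passing from n to `suc n` the argument moves from z = q^{n+1} to qz, and the factor
  -- `1# - q ^ suc n` in the recursion of `shanks` is the 1 - z that the q-difference equation asks
  -- for. Its error term and the appended summand together carry the factor 1 + z, which completes
  -- `poch⁺ (suc n)`.
  shanks-at-power : ∀ n → shanks n (q ^ suc n) ≈ θ n * poch⁺ n
  shanks-at-power zero    = sym (*-identityʳ 1#)
  shanks-at-power (suc n) = begin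
    (1# - z) * shanks n (q * z) + (1# + 1#) * P * (- (q * z)) ^ suc n
      ≈⟨ +-cong (shanks-functional n z) (*-congˡ ([-qz]^ z (suc n))) ⟩
    (1# + z) * shanks n z + (1# + 1#) * P * Y + (1# + 1#) * P * (z * Y)
      ≈⟨ +-congʳ (+-congʳ (*-congˡ (shanks-at-power n))) ⟩
    (1# + z) * (θ n * P) + (1# + 1#) * P * Y + (1# + 1#) * P * (z * Y)
      ≈⟨ solve 4 (λ z t P Y →
           (:1 :+ z) :* (t :* P) :+ (:1 :+ :1) :* P :* Y :+ (:1 :+ :1) :* P :* (z :* Y) :=
           (t :+ (:1 :+ :1) :* Y) :* ((:1 :+ z) :* P)) refl z (θ n) P Y ⟩
    (θ n + (1# + 1#) * Y) * ((1# + z) * P) ∎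
    where
    z = q ^ suc n
    P = poch⁺ n
    Y = (- z) ^ suc n

  -- Only the summand s = 0 is free of z. At z = q^{n+1} all the others lie beyond the truncation
  -- order.
  shanks-constant-term : ∀ n z → ∃[ b ] shanks n z ≈ poch⁻ n + z * b
  shanks-constant-term zero    z = 0# , solve 1 (λ z → :1 := :1 :+ z :* :0) refl z
  shanks-constant-term (suc n) z with shanks-constant-term n z
  ... | b , eq = _ , (begin
    (1# - Q) * shanks n z + (1# + 1#) * P * ((- z) * Y)
      ≈⟨ +-congʳ (*-congˡ eq) ⟩
    (1# - Q) * (poch⁻ n + z * b) + (1# + 1#) * P * ((- z) * Y)
      ≈⟨ solve 6 (λ z Q b W P Y →
           (:1 :- Q) :* (W :+ z :* b) :+ (:1 :+ :1) :* P :* ((:- z) :* Y) :=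
           (:1 :- Q) :* W :+ z :* ((:1 :- Q) :* b :- (:1 :+ :1) :* P :* Y)) refl z Q b (poch⁻ n) P Y ⟩
    (1# - Q) * poch⁻ n + z * ((1# - Q) * b - (1# + 1#) * P * Y) ∎)
    where
    Q = q ^ suc n
    P = poch⁺ n
    Y = (- z) ^ n

  -- The limit n → ∞ is ∑ (-1)^s q^{s²} = (q;q)_∞ / (-q;q)_∞.
  gauss : ∀ n → ∃[ b ] θ n * poch⁺ n ≈ poch⁻ n + q ^ suc n * b
  gauss n with shanks-constant-term n (q ^ suc n)
  ... | b , eq = b , trans (sym (shanks-at-power n)) eq

-- Formal power series over a commutative ring.

module PowerSeries {c ℓ : Level} (R : CommutativeRing c ℓ) where
  open CommutativeRing R
  open Algebra.Properties.Ring ring using (-0#≈0#)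
  open CommutativeRingSolver R
  open Relation.Binary.Reasoning.Setoid setoid

  Series : Set c
  Series = ℕ → Carrier

  infix 4 _≋_
  -- Wrapped in a record so that both series can be inferred from the type of an equation.
  record _≋_ (f g : Series) : Set ℓ where
    constructor pointwise
    field at : ∀ n → f n ≈ g n
  open _≋_ public

  infixl 7 _⊛_
  _⊛_ : Series → Series → Series
  (f ⊛ g) zero    = f 0 * g 0
  (f ⊛ g) (suc n) = f 0 * g (suc n) + ((f ∘ suc) ⊛ g) n

  κ : Carrier → Series
  κ a zero    = a
  κ a (suc n) = 0#

  shift : ℕ → Series → Series
  shift zero    f n       = f n
  shift (suc d) f zero    = 0#
  shift (suc d) f (suc n) = shift d f n

  X : Series
  X = shift 1 (κ 1#)

  -- The bound matters: overpartition series agree with their truncated products only up to the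
  -- truncation order.
  ⊛-cong-≤ : ∀ {f f′ g g′} n → (∀ i → i ≤ n → f i ≈ f′ i) → (∀ i → i ≤ n → g i ≈ g′ i) → (f ⊛ g) n ≈ (f′ ⊛ g′) n
  ⊛-cong-≤ zero    p q = *-cong (p 0 z≤n) (q 0 z≤n)
  ⊛-cong-≤ (suc n) p q = +-cong (*-cong (p 0 z≤n) (q (suc n) ℕ.≤-refl))
    (⊛-cong-≤ n (λ i i≤n → p (suc i) (s≤s i≤n)) (λ i i≤n → q i (ℕ.m≤n⇒m≤1+n i≤n)))

  private
    ⊛-distribʳ : ∀ f g h n → ((λ i → g i + h i) ⊛ f) n ≈ (g ⊛ f) n + (h ⊛ f) n
    ⊛-distribʳ f g h zero    = distribʳ _ _ _
    ⊛-distribʳ f g h (suc n) = trans (+-congˡ (⊛-distribʳ f (g ∘ suc) (h ∘ suc) n))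
      (solve 5 (λ x y z u v → (y :+ z) :* x :+ (u :+ v) := (y :* x :+ u) :+ (z :* x :+ v)) refl _ _ _ _ _)

    scale-⊛ : ∀ a f g n → ((λ i → a * f i) ⊛ g) n ≈ a * (f ⊛ g) n
    scale-⊛ a f g zero    = *-assoc _ _ _
    scale-⊛ a f g (suc n) = trans (+-congˡ (scale-⊛ a (f ∘ suc) g n))
      (solve 4 (λ a x y z → a :* x :* y :+ a :* z := a :* (x :* y :+ z)) refl _ _ _ _)

    0-⊛ : ∀ g n → ((λ _ → 0#) ⊛ g) n ≈ 0#
    0-⊛ g zero    = zeroˡ _
    0-⊛ g (suc n) = trans (+-cong (zeroˡ _) (0-⊛ g n)) (+-identityˡ 0#)

    -- The mirror image of the defining recursion, splitting off the constant term of the right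
    -- factor. Commutativity results from playing the two recursions against each other.
    ⊛-suc : ∀ f g n → (f ⊛ g) (suc n) ≈ (f ⊛ (g ∘ suc)) n + f (suc n) * g 0
    ⊛-suc f g zero    = refl
    ⊛-suc f g (suc n) = trans (+-congˡ (⊛-suc (f ∘ suc) g n)) (sym (+-assoc _ _ _))

    ⊛-comm : ∀ f g n → (f ⊛ g) n ≈ (g ⊛ f) n
    ⊛-comm f g zero    = *-comm _ _
    ⊛-comm f g (suc n) = begin
      f 0 * g (suc n) + ((f ∘ suc) ⊛ g) n  ≈⟨ +-cong (*-comm _ _) (⊛-comm (f ∘ suc) g n) ⟩
      g (suc n) * f 0 + (g ⊛ (f ∘ suc)) n  ≈⟨ +-comm _ _ ⟩
      (g ⊛ (f ∘ suc)) n + g (suc n) * f 0  ≈⟨ ⊛-suc g f n ⟨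
      (g ⊛ f) (suc n)                      ∎

    ⊛-assoc : ∀ f g h n → ((f ⊛ g) ⊛ h) n ≈ (f ⊛ (g ⊛ h)) n
    ⊛-assoc f g h zero    = *-assoc _ _ _
    ⊛-assoc f g h (suc n) = begin
      f 0 * g 0 * h (suc n) + ((λ i → f 0 * g (suc i) + ((f ∘ suc) ⊛ g) i) ⊛ h) n
        ≈⟨ +-congˡ (⊛-distribʳ h _ _ n) ⟩
      f 0 * g 0 * h (suc n) + (((λ i → f 0 * g (suc i)) ⊛ h) n + (((f ∘ suc) ⊛ g) ⊛ h) n)
        ≈⟨ +-congˡ (+-cong (scale-⊛ (f 0) (g ∘ suc) h n) (⊛-assoc (f ∘ suc) g h n)) ⟩
      f 0 * g 0 * h (suc n) + (f 0 * ((g ∘ suc) ⊛ h) n + ((f ∘ suc) ⊛ (g ⊛ h)) n)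
        ≈⟨ solve 5 (λ x y z u v → x :* y :* z :+ (x :* u :+ v) := x :* (y :* z :+ u) :+ v) refl _ _ _ _ _ ⟩
      f 0 * (g 0 * h (suc n) + ((g ∘ suc) ⊛ h) n) + ((f ∘ suc) ⊛ (g ⊛ h)) n ∎

  κ-⊛ : ∀ a f n → (κ a ⊛ f) n ≈ a * f n
  κ-⊛ a f zero    = refl
  κ-⊛ a f (suc n) = trans (+-congˡ (0-⊛ f n)) (+-identityʳ _)

  seriesRing : CommutativeRing c ℓ
  seriesRing = record
    { Carrier = Series
    ; _≈_ = _≋_
    ; _+_ = λ f g n → f n + g n
    ; _*_ = _⊛_
    ; -_  = λ f n → - f n
    ; 0#  = λ _ → 0#
    ; 1#  = κ 1#
    ; isCommutativeRing = record
      { isRing = record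
        { +-isAbelianGroup = record
          { isGroup = record
            { isMonoid = record
              { isSemigroup = record
                { isMagma = record
                  { isEquivalence = record
                    { refl  = pointwise λ _ → refl
                    ; sym   = λ p → pointwise λ n → sym (at p n)
                    ; trans = λ p q → pointwise λ n → trans (at p n) (at q n)
                    }
                  ; ∙-cong = λ p q → pointwise λ n → +-cong (at p n) (at q n)
                  }
                ; assoc = λ f g h → pointwise λ n → +-assoc _ _ _
                }
              ; identity = (λ f → pointwise λ n → +-identityˡ _) , (λ f → pointwise λ n → +-identityʳ _)
              }
            ; inverse = (λ f → pointwise λ n → -‿inverseˡ _) , (λ f → pointwise λ n → -‿inverseʳ _)
            ; ⁻¹-cong = λ p → pointwise λ n → -‿cong (at p n)
            }
          ; comm = λ f g → pointwise λ n → +-comm _ _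
          }
        ; *-cong = λ p q → pointwise λ n → ⊛-cong-≤ n (λ i _ → at p i) (λ i _ → at q i)
        ; *-assoc = λ f g h → pointwise (⊛-assoc f g h)
        ; *-identity = (λ f → pointwise λ n → trans (κ-⊛ 1# f n) (*-identityˡ _))
                     , (λ f → pointwise λ n → trans (⊛-comm f (κ 1#) n) (trans (κ-⊛ 1# f n) (*-identityˡ _)))
        ; distrib = (λ f g h → pointwise λ n → trans (⊛-comm f _ n)
                       (trans (⊛-distribʳ f g h n) (+-cong (⊛-comm g f n) (⊛-comm h f n))))
                  , (λ f g h → pointwise (⊛-distribʳ f g h))
        }
      ; *-comm = λ f g → pointwise (⊛-comm f g)
      }
    }

  module S = CommutativeRing seriesRing
  open Algebra.Properties.CommutativeSemiring.Exp S.commutativeSemiring using (_^_; ^-congˡ; ^-distrib-*; ^-assocʳ)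

  private
    X-⊛ : ∀ f n → (X ⊛ f) n ≈ shift 1 f n
    X-⊛ f zero    = zeroˡ _
    X-⊛ f (suc n) = trans (+-cong (zeroˡ _) (trans (κ-⊛ 1# f n) (*-identityˡ _))) (+-identityˡ _)

    shift-cong : ∀ d {f g} → f ≋ g → shift d f ≋ shift d g
    shift-cong zero    p = p
    shift-cong (suc d) p = pointwise λ { zero → refl ; (suc n) → at (shift-cong d p) n }

    shift-suc : ∀ d f → shift 1 (shift d f) ≋ shift (suc d) f
    shift-suc d f = pointwise λ { zero → refl ; (suc n) → refl }

  X^-⊛ : ∀ d f → X ^ d ⊛ f ≋ shift d f
  X^-⊛ zero    f = S.*-identityˡ f
  X^-⊛ (suc d) f = S.trans (S.*-assoc X (X ^ d) f)
    (S.trans (pointwise (X-⊛ (X ^ d ⊛ f))) (S.trans (shift-cong 1 (X^-⊛ d f)) (shift-suc d f)))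

  scale-shift : ∀ a d f n → shift d (λ i → a * f i) n ≈ a * shift d f n
  scale-shift a zero    f n       = refl
  scale-shift a (suc d) f zero    = sym (zeroʳ a)
  scale-shift a (suc d) f (suc n) = scale-shift a d f n

  monomial : Carrier → ℕ → Series
  monomial a d = κ a ⊛ X ^ d

  monomial-⊛ : ∀ a d f n → (monomial a d ⊛ f) n ≈ a * shift d f n
  monomial-⊛ a d f n = trans (at (S.*-assoc (κ a) (X ^ d) f) n)
    (trans (κ-⊛ a _ n) (*-congˡ (at (X^-⊛ d f) n)))

  shift-view : ∀ d f n → (n < d × shift d f n ≡ 0#) ⊎ (∃[ k ] n ≡ d ℕ.+ k × shift d f n ≡ f k)
  shift-view zero    f n       = inj₂ (n , ≡.refl , ≡.refl)
  shift-view (suc d) f zero    = inj₁ (s≤s z≤n , ≡.refl)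
  shift-view (suc d) f (suc n) with shift-view d f n
  ... | inj₁ (n<d , eq)     = inj₁ (s≤s n<d , eq)
  ... | inj₂ (k , n≡ , eq) = inj₂ (k , ≡.cong suc n≡ , eq)

  κ-cong : ∀ {a b} → a ≈ b → κ a ≋ κ b
  κ-cong p = pointwise λ { zero → p ; (suc n) → refl }

  κ-* : ∀ a b → κ (a * b) ≋ κ a ⊛ κ b
  κ-* a b = pointwise λ { zero → refl ; (suc n) → sym (trans (κ-⊛ a (κ b) (suc n)) (zeroʳ a)) }

  κ-+ : ∀ a b → κ (a + b) ≋ κ a S.+ κ b
  κ-+ a b = pointwise λ { zero → refl ; (suc n) → sym (+-identityˡ 0#) }

  κ-neg : ∀ a → κ (- a) ≋ S.- κ a
  κ-neg a = pointwise λ { zero → refl ; (suc n) → sym -0#≈0# }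

  κ-0 : κ 0# ≋ S.0#
  κ-0 = pointwise λ { zero → refl ; (suc n) → refl }

  -- The coefficient is existential because vanishing arguments look only at the exponent.
  IsMonomial : ℕ → Series → Set _
  IsMonomial d f = ∃[ a ] f ≋ monomial a d

  private
    κ-^ : ∀ a n → ∃[ b ] κ a ^ n ≋ κ b
    κ-^ a zero    = 1# , S.refl
    κ-^ a (suc n) with κ-^ a n
    ... | b , eq = a * b , S.trans (S.*-congˡ eq) (S.sym (κ-* a b))

  ^-isMonomial : ∀ {d f} n → IsMonomial d f → IsMonomial (d ℕ.* n) (f ^ n)
  ^-isMonomial {d} {f} n (a , eq) with κ-^ a n
  ... | b , eq′ = b , S.trans (^-congˡ n eq)
    (S.trans (^-distrib-* (κ a) (X ^ d) n) (S.*-cong eq′ (^-assocʳ X d n)))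

  neg-isMonomial : ∀ {d f} → IsMonomial d f → IsMonomial d (S.- f)
  neg-isMonomial {d} {f} (a , eq) = - a , S.trans (S.-‿cong eq)
    (S.trans (-‿distribˡ-* (κ a) (X ^ d)) (S.*-congʳ (S.sym (κ-neg a))))
    where open Algebra.Properties.Ring S.ring using (-‿distribˡ-*)

  -- Series whose coefficients vanish on a set of exponents.

  Vanishes : (ℕ → Set) → Series → Set ℓ
  Vanishes I f = ∀ m → I m → f m ≈ 0#

  -- Closure under subtracting d: the coefficient of X^d f at d + m is that of f at m, so m must
  -- stay in the set.
  ClosedUnder : ℕ → (ℕ → Set) → Set
  ClosedUnder d I = ∀ m → I (d ℕ.+ m) → I m

  module _ {I : ℕ → Set} where
    vanishes-≋ : ∀ {f g} → f ≋ g → Vanishes I f → Vanishes I g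
    vanishes-≋ eq v m i = trans (sym (at eq m)) (v m i)

    vanishes-+ : ∀ {f g} → Vanishes I f → Vanishes I g → Vanishes I (f S.+ g)
    vanishes-+ v w m i = trans (+-cong (v m i) (w m i)) (+-identityˡ 0#)

    vanishes-monomial-⊛ : ∀ a d {f} → ClosedUnder d I → Vanishes I f → Vanishes I (monomial a d ⊛ f)
    vanishes-monomial-⊛ a d {f} closed v m i = trans (monomial-⊛ a d f m) (trans (*-congˡ lemma) (zeroʳ a))
      where
      lemma : shift d f m ≈ 0#
      lemma with shift-view d f m
      ... | inj₁ (_ , eq)          = reflexive eq
      ... | inj₂ (k , ≡.refl , eq) = trans (reflexive eq) (v k (closed k i))

    vanishes-monomial : ∀ a d → ¬ I d → Vanishes I (monomial a d)
    vanishes-monomial a d ¬Id m i = trans (at (S.sym (S.*-identityʳ (monomial a d))) m)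
      (trans (monomial-⊛ a d (κ 1#) m) (trans (*-congˡ lemma) (zeroʳ a)))
      where
      lemma : shift d (κ 1#) m ≈ 0#
      lemma with shift-view d (κ 1#) m
      ... | inj₁ (_ , eq)              = reflexive eq
      ... | inj₂ (zero , ≡.refl , eq)  = contradiction (≡.subst I (ℕ.+-identityʳ d) i) ¬Id
      ... | inj₂ (suc k , ≡.refl , eq) = reflexive eq

    -- Division by a unit without its inverse. The coefficient of the product at m is that of f at m
    -- plus a multiple of an earlier one, zero by strong induction; the positive exponent `suc d`
    -- makes it strictly earlier.
    vanishes-cancel : ∀ a d {f} → ClosedUnder (suc d) I →
      Vanishes I ((S.1# S.+ monomial a (suc d)) ⊛ f) → Vanishes I f
    vanishes-cancel a d {f} closed v = <-rec (λ m → I m → f m ≈ 0#) step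
      where
      step : ∀ m → (∀ {k} → k < m → I k → f k ≈ 0#) → I m → f m ≈ 0#
      step m rec i = begin
        f m
          ≈⟨ +-identityʳ _ ⟨
        f m + 0#
          ≈⟨ +-congˡ (trans (*-congˡ lemma) (zeroʳ a)) ⟨
        f m + a * shift (suc d) f m
          ≈⟨ +-cong (at (S.*-identityˡ f) m) (monomial-⊛ a (suc d) f m) ⟨
        (S.1# ⊛ f) m + (monomial a (suc d) ⊛ f) m
          ≈⟨ at (S.distribʳ f S.1# (monomial a (suc d))) m ⟨
        ((S.1# S.+ monomial a (suc d)) ⊛ f) m
          ≈⟨ v m i ⟩
        0# ∎
        where
        lemma : shift (suc d) f m ≈ 0#
        lemma with shift-view (suc d) f m
        ... | inj₁ (_ , eq)          = reflexive eq
        ... | inj₂ (k , ≡.refl , eq) = trans (reflexive eq) (rec (s≤s (ℕ.m≤n+m k d)) (closed k i))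

    vanishes-below : ∀ a d f → (∀ m → I m → m < d) → Vanishes I (monomial a d ⊛ f)
    vanishes-below a d f I<d m i with shift-view d f m
    ... | inj₁ (_ , eq)          = trans (monomial-⊛ a d f m) (trans (*-congˡ (reflexive eq)) (zeroʳ a))
    ... | inj₂ (k , ≡.refl , eq) = contradiction (I<d m i) (ℕ.≤⇒≯ (ℕ.m≤m+n d k))

    vanishes-isMonomial : ∀ {d g} → IsMonomial d g → ¬ I d → Vanishes I g
    vanishes-isMonomial {d} (a , eq) ¬Id = vanishes-≋ (S.sym eq) (vanishes-monomial a d ¬Id)

    vanishes-isMonomial-cancel : ∀ {d g f} → IsMonomial (suc d) g → ClosedUnder (suc d) I →
      Vanishes I ((S.1# S.+ g) ⊛ f) → Vanishes I f
    vanishes-isMonomial-cancel {d} (a , eq) closed v =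
      vanishes-cancel a d closed (vanishes-≋ (S.*-congʳ (S.+-congˡ eq)) v)

    vanishes-isMonomial-⊛ : ∀ {d g} f → IsMonomial d g → (∀ m → I m → m < d) → Vanishes I (g ⊛ f)
    vanishes-isMonomial-⊛ {d} f (a , eq) I<d = vanishes-≋ (S.*-congʳ (S.sym eq)) (vanishes-below a d f I<d)

-- Independence of the fuel, and Boolean comparisons.

flaggedComps-fuel : ∀ {f f′} m → m ≤ f → m ≤ f′ → flaggedComps f m ≡ flaggedComps f′ m
flaggedComps-fuel zero    _         _          = ≡.refl
flaggedComps-fuel (suc m) (s≤s m≤f) (s≤s m≤f′) = concatMap-cong (λ k → concatMap-cong (λ b →
  ≡.cong (map ((suc k , b) ∷_)) (flaggedComps-fuel (m ∸ k)
    (ℕ.≤-trans (ℕ.m∸n≤m m k) m≤f) (ℕ.≤-trans (ℕ.m∸n≤m m k) m≤f′))) (true ∷ false ∷ [])) (upTo (suc m))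

-- Trichotomy recorded as the Boolean equations that `rewrite` can feed into the guards of the
-- enumerations, for the bounds n and `suc n` simultaneously.
data Compareᵇ (k n : ℕ) : Set where
  less    : (k <ᵇ n) ≡ true  → (k ≡ᵇ n) ≡ false → (k <ᵇ suc n) ≡ true  → Compareᵇ k n
  equal   : (k <ᵇ n) ≡ false → k ≡ n            → (k <ᵇ suc n) ≡ true  → Compareᵇ k n
  greater : (k <ᵇ n) ≡ false → (k ≡ᵇ n) ≡ false → (k <ᵇ suc n) ≡ false → Compareᵇ k n

compareᵇ : ∀ k n → Compareᵇ k n
compareᵇ zero    zero    = equal ≡.refl ≡.refl ≡.refl
compareᵇ zero    (suc n) = less ≡.refl ≡.refl ≡.refl
compareᵇ (suc k) zero    = greater ≡.refl ≡.refl ≡.refl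
compareᵇ (suc k) (suc n) with compareᵇ k n
... | less p q r    = less p q r
... | equal p q r   = equal p (≡.cong suc q) r
... | greater p q r = greater p q r

≡ᵇ-refl : ∀ n → (n ≡ᵇ n) ≡ true
≡ᵇ-refl zero    = ≡.refl
≡ᵇ-refl (suc n) = ≡ᵇ-refl n

<⇒<ᵇ≡true : ∀ {m n} → m < n → (m <ᵇ n) ≡ true
<⇒<ᵇ≡true {zero}  (s≤s _)         = ≡.refl
<⇒<ᵇ≡true {suc m} (s≤s (s≤s m≤n)) = <⇒<ᵇ≡true {m} (s≤s m≤n)

-- Finite sums over lists.

module ListSum {c ℓ : Level} (R : CommutativeRing c ℓ) where
  open CommutativeRing R
  open Algebra.Properties.CommutativeSemigroup +-commutativeSemigroup using (interchange)
  open PowerSeries R using (Series; shift; _⊛_)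

  private
    variable
      a b : Level
      A : Set a
      B : Set b

  ∑ : (A → Carrier) → List A → Carrier
  ∑ f []       = 0#
  ∑ f (x ∷ xs) = f x + ∑ f xs

  ∑-cong : ∀ {f g : A → Carrier} → (∀ x → f x ≈ g x) → ∀ xs → ∑ f xs ≈ ∑ g xs
  ∑-cong p []       = refl
  ∑-cong p (x ∷ xs) = +-cong (p x) (∑-cong p xs)

  ∑-0 : ∀ {f : A → Carrier} → (∀ x → f x ≈ 0#) → ∀ xs → ∑ f xs ≈ 0#
  ∑-0 p []       = refl
  ∑-0 p (x ∷ xs) = trans (+-cong (p x) (∑-0 p xs)) (+-identityˡ 0#)

  ∑-+ : ∀ (f g : A → Carrier) xs → ∑ (λ x → f x + g x) xs ≈ ∑ f xs + ∑ g xs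
  ∑-+ f g []       = sym (+-identityˡ 0#)
  ∑-+ f g (x ∷ xs) = trans (+-congˡ (∑-+ f g xs)) (interchange _ _ _ _)

  ∑-*ˡ : ∀ y (f : A → Carrier) xs → ∑ (λ x → y * f x) xs ≈ y * ∑ f xs
  ∑-*ˡ y f []       = sym (zeroʳ y)
  ∑-*ˡ y f (x ∷ xs) = trans (+-congˡ (∑-*ˡ y f xs)) (sym (distribˡ _ _ _))

  ∑-*ʳ : ∀ y (f : A → Carrier) xs → ∑ (λ x → f x * y) xs ≈ ∑ f xs * y
  ∑-*ʳ y f []       = sym (zeroˡ y)
  ∑-*ʳ y f (x ∷ xs) = trans (+-congˡ (∑-*ʳ y f xs)) (sym (distribʳ _ _ _))

  ∑-++ : ∀ (f : A → Carrier) xs ys → ∑ f (xs ++ ys) ≈ ∑ f xs + ∑ f ys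
  ∑-++ f []       ys = sym (+-identityˡ _)
  ∑-++ f (x ∷ xs) ys = trans (+-congˡ (∑-++ f xs ys)) (sym (+-assoc _ _ _))

  ∑-map : ∀ (f : B → Carrier) (g : A → B) xs → ∑ f (map g xs) ≡ ∑ (f ∘ g) xs
  ∑-map f g []       = ≡.refl
  ∑-map f g (x ∷ xs) = ≡.cong (f (g x) +_) (∑-map f g xs)

  ∑-concatMap : ∀ (f : B → Carrier) (g : A → List B) xs → ∑ f (concatMap g xs) ≈ ∑ (λ x → ∑ f (g x)) xs
  ∑-concatMap f g []       = refl
  ∑-concatMap f g (x ∷ xs) = trans (∑-++ f (g x) (concatMap g xs)) (+-congˡ (∑-concatMap f g xs))

  ∑-filterᵇ : ∀ (f : A → Carrier) p xs → ∑ f (filterᵇ p xs) ≈ ∑ (λ x → if p x then f x else 0#) xs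
  ∑-filterᵇ f p []       = refl
  ∑-filterᵇ f p (x ∷ xs) with p x
  ... | true  = +-congˡ (∑-filterᵇ f p xs)
  ... | false = trans (∑-filterᵇ f p xs) (sym (+-identityˡ _))

  ∑-applyUpTo : ∀ (f : A → Carrier) g n → ∑ f (applyUpTo g n) ≡ ∑ (f ∘ g) (upTo n)
  ∑-applyUpTo f g zero    = ≡.refl
  ∑-applyUpTo f g (suc n) = ≡.cong (f (g 0) +_)
    (≡.trans (∑-applyUpTo f (g ∘ suc) n) (≡.sym (∑-applyUpTo (f ∘ g) suc n)))

  ∑-upTo-suc : ∀ (f : ℕ → Carrier) n → ∑ f (upTo (suc n)) ≡ f 0 + ∑ (f ∘ suc) (upTo n)
  ∑-upTo-suc f n = ≡.cong (f 0 +_) (∑-applyUpTo f suc n)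

  ∑-upTo-cong : ∀ {f g : ℕ → Carrier} n → (∀ k → k < n → f k ≈ g k) → ∑ f (upTo n) ≈ ∑ g (upTo n)
  ∑-upTo-cong         zero    p = refl
  ∑-upTo-cong {f} {g} (suc n) p = trans (reflexive (∑-upTo-suc f n))
    (trans (+-cong (p 0 (s≤s z≤n)) (∑-upTo-cong n (λ k k<n → p (suc k) (s≤s k<n))))
      (sym (reflexive (∑-upTo-suc g n))))

  ∑-upTo-⊛ : ∀ (f g : Series) n → ∑ (λ j → f j * g (n ∸ j)) (upTo (suc n)) ≈ (f ⊛ g) n
  ∑-upTo-⊛ f g zero    = +-identityʳ _
  ∑-upTo-⊛ f g (suc n) = trans (reflexive (∑-upTo-suc (λ j → f j * g (suc n ∸ j)) (suc n)))
    (+-congˡ (∑-upTo-⊛ (f ∘ suc) g n))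

  ∑-upTo-shift : ∀ (f : Series) d n → ∑ (λ k → if k ≡ᵇ d then f (n ∸ k) else 0#) (upTo (suc n)) ≈ shift d f n
  ∑-upTo-shift f zero    n       = trans (reflexive (∑-upTo-suc (λ k → if k ≡ᵇ 0 then f (n ∸ k) else 0#) n))
    (trans (+-congˡ (∑-0 (λ _ → refl) (upTo n))) (+-identityʳ _))
  ∑-upTo-shift f (suc d) zero    = +-identityˡ 0#
  ∑-upTo-shift f (suc d) (suc n) =
    trans (reflexive (∑-upTo-suc (λ k → if k ≡ᵇ suc d then f (suc n ∸ k) else 0#) (suc n)))
      (trans (+-identityˡ _) (∑-upTo-shift f d n))

-- Weighted overpartitions and their product formula.

module Overpartitions {c ℓ : Level} (R : CommutativeRing c ℓ) (w : ℕ → CommutativeRing.Carrier R) where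
  open CommutativeRing R
  open PowerSeries R
  open ListSum R
  open Relation.Binary.Reasoning.Setoid setoid

  weight : FlaggedList → Carrier
  weight []            = 1#
  weight ((c , _) ∷ π) = w c * weight π

  -- The weight of a legal list and zero for any other. `ok` is the condition the preceding part
  -- puts on the next one, so the filter unfolds part by part.
  chain : (ℕ × Bool → Bool) → FlaggedList → Carrier
  chain ok []      = 1#
  chain ok (y ∷ π) = if positive y ∧ ok y then w (proj₁ y) * chain (pairOK y) π else 0#

  private
    if-then-* : ∀ b x {y z} → (if b then y else 0#) ≈ z → (if b then x * y else 0#) ≈ x * z
    if-then-* true  x eq = *-congˡ eq
    if-then-* false x eq = trans (sym (zeroʳ x)) (*-congˡ eq)

    chain-sorted : ∀ x π → (if all positive π ∧ sortedOK (x ∷ π) then weight π else 0#) ≈ chain (pairOK x) π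
    chain-sorted x []      = refl
    chain-sorted x (y ∷ π) with positive y | pairOK x y
    ... | false | _     = refl
    ... | true  | false rewrite ∧-zeroʳ (all positive π) = refl
    ... | true  | true  = if-then-* (all positive π ∧ sortedOK (y ∷ π)) (w (proj₁ y)) (chain-sorted y π)

  chain-isOverpartition : ∀ π → (if isOverpartition π then weight π else 0#) ≈ chain (λ _ → true) π
  chain-isOverpartition []      = refl
  chain-isOverpartition (y ∷ π) with positive y
  ... | false = refl
  ... | true  = if-then-* (all positive π ∧ sortedOK (y ∷ π)) (w (proj₁ y)) (chain-sorted y π)

  chains : (ℕ × Bool → Bool) → Series
  chains ok m = ∑ (chain ok) (flaggedComps m m)

  ∑-overpartitions : ∀ m → ∑ weight (overpartitions m) ≈ chains (λ _ → true) m
  ∑-overpartitions m = trans (∑-filterᵇ weight isOverpartition (flaggedComps m m))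
    (∑-cong chain-isOverpartition (flaggedComps m m))

  -- below c enumerates what may follow a part of size c, whose own flag pairOK ignores.
  atMost below : ℕ → Series
  atMost N = chains (λ y → proj₁ y <ᵇ suc N)
  below c  = chains (pairOK (c , true))

  private
    headed : (ℕ × Bool → Bool) → ℕ → ℕ → Bool → Carrier
    headed ok m k b = if ok (suc k , b) then w (suc k) * below (suc k) (m ∸ k) else 0#

  chains-suc : ∀ ok m → chains ok (suc m) ≈ ∑ (λ k → headed ok m k true + headed ok m k false) (upTo (suc m))
  chains-suc ok m = trans (∑-concatMap (chain ok) lists (upTo (suc m))) (∑-cong term (upTo (suc m)))
    where
    lists : ℕ → List FlaggedList
    lists k = concatMap (λ b → map ((suc k , b) ∷_) (flaggedComps m (m ∸ k))) (true ∷ false ∷ [])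

    first-part : ∀ k b → ∑ (chain ok) (map ((suc k , b) ∷_) (flaggedComps m (m ∸ k)))
      ≈ headed ok m k b
    -- The tail is enumerated with fuel `m`, whereas `below` takes the size itself as fuel.
    first-part k b rewrite flaggedComps-fuel (m ∸ k) (ℕ.m∸n≤m m k) ℕ.≤-refl
      | ∑-map (chain ok) ((suc k , b) ∷_) (flaggedComps (m ∸ k) (m ∸ k)) with ok (suc k , b)
    ... | true  = ∑-*ˡ (w (suc k)) (chain (pairOK (suc k , true))) (flaggedComps (m ∸ k) (m ∸ k))
    ... | false = ∑-0 (λ _ → refl) (flaggedComps (m ∸ k) (m ∸ k))

    term : ∀ k → ∑ (chain ok) (lists k) ≈ headed ok m k true + headed ok m k false
    term k = trans (∑-concatMap (chain ok) (λ b → map ((suc k , b) ∷_) (flaggedComps m (m ∸ k))) (true ∷ false ∷ []))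
      (+-cong (first-part k true) (trans (+-identityʳ _) (first-part k false)))

  -- No part exceeds the total m, so a bound N ≥ m excludes nothing.
  chains≈atMost : ∀ {m N} → m ≤ N → chains (λ _ → true) m ≈ atMost N m
  chains≈atMost {zero}          _   = refl
  chains≈atMost {suc m} {suc N} (s≤s m≤N) = begin
    chains (λ _ → true) (suc m)  ≈⟨ chains-suc _ m ⟩
    ∑ _ (upTo (suc m))           ≈⟨ ∑-upTo-cong (suc m) term ⟩
    ∑ _ (upTo (suc m))           ≈⟨ chains-suc _ m ⟨
    atMost (suc N) (suc m)       ∎
    where
    term : ∀ k → k < suc m → headed (λ _ → true) m k true + headed (λ _ → true) m k false
      ≈ headed (λ y → proj₁ y <ᵇ suc (suc N)) m k true + headed (λ y → proj₁ y <ᵇ suc (suc N)) m k false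
    term k (s≤s k≤m) rewrite <⇒<ᵇ≡true (s≤s (ℕ.≤-trans k≤m m≤N)) = refl

  atMost-0 : atMost 0 ≋ S.1#
  atMost-0 = pointwise λ where
    zero    → +-identityʳ 1#
    (suc m) → trans (chains-suc _ m) (∑-0 (λ _ → +-identityˡ 0#) (upTo (suc m)))

  module _ (N : ℕ) where
    private
      -- Overpartitions whose first part is `suc N` with one prescribed flag.
      x·U : Series
      x·U = monomial (w (suc N)) (suc N) ⊛ below (suc N)

      top : ℕ → ℕ → Carrier
      top m k = if k ≡ᵇ N then w (suc N) * below (suc N) (m ∸ k) else 0#

      ∑-top : ∀ m → ∑ (top m) (upTo (suc m)) ≈ x·U (suc m)
      ∑-top m = begin
        ∑ (top m) (upTo (suc m))                     ≈⟨ ∑-upTo-shift (λ i → w (suc N) * below (suc N) i) N m ⟩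
        shift N (λ i → w (suc N) * below (suc N) i) m ≈⟨ scale-shift (w (suc N)) N (below (suc N)) m ⟩
        w (suc N) * shift N (below (suc N)) m         ≈⟨ monomial-⊛ (w (suc N)) (suc N) (below (suc N)) (suc m) ⟨
        x·U (suc m)                                   ∎

      x·U-0 : x·U 0 ≈ 0#
      x·U-0 = trans (monomial-⊛ (w (suc N)) (suc N) (below (suc N)) 0) (zeroʳ _)

    -- Either all parts are at most N, or the first part is `suc N`, overlined or not: hence the two
    -- copies.
    atMost-suc : atMost (suc N) ≋ atMost N S.+ (x·U S.+ x·U)
    atMost-suc = pointwise λ where
        zero    → sym (trans (+-congˡ (trans (+-cong x·U-0 x·U-0) (+-identityˡ 0#))) (+-identityʳ _))
        (suc m) → begin
          atMost (suc N) (suc m)  ≈⟨ chains-suc _ m ⟩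
          ∑ _ (upTo (suc m))      ≈⟨ ∑-cong (term m) (upTo (suc m)) ⟩
          ∑ (λ k → (headed ok m k true + headed ok m k false) + (top m k + top m k)) (upTo (suc m))
                                  ≈⟨ ∑-+ _ _ (upTo (suc m)) ⟩
          ∑ _ (upTo (suc m)) + ∑ (λ k → top m k + top m k) (upTo (suc m))
                                  ≈⟨ +-cong (sym (chains-suc _ m)) (∑-+ (top m) (top m) (upTo (suc m))) ⟩
          atMost N (suc m) + (∑ (top m) (upTo (suc m)) + ∑ (top m) (upTo (suc m)))
                                  ≈⟨ +-congˡ (+-cong (∑-top m) (∑-top m)) ⟩
          atMost N (suc m) + (x·U (suc m) + x·U (suc m)) ∎
      where
      ok ok⁺ : ℕ × Bool → Bool
      ok y  = proj₁ y <ᵇ suc N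
      ok⁺ y = proj₁ y <ᵇ suc (suc N)

      term : ∀ m k → headed ok⁺ m k true + headed ok⁺ m k false
        ≈ (headed ok m k true + headed ok m k false) + (top m k + top m k)
      term m k with compareᵇ k N
      ... | less p q r       rewrite p | q | r = sym (trans (+-congˡ (+-identityˡ 0#)) (+-identityʳ _))
      ... | equal p ≡.refl r rewrite p | r | ≡ᵇ-refl k = sym (trans (+-congʳ (+-identityˡ 0#)) (+-identityˡ _))
      ... | greater p q r    rewrite p | q | r = sym (trans (+-congˡ (+-identityˡ 0#)) (+-identityʳ _))

    -- After a part `suc N` a repetition of it must be non-overlined: hence a single copy.
    below-suc : below (suc N) ≋ atMost N S.+ x·U
    below-suc = pointwise λ where
        zero    → sym (trans (+-congˡ x·U-0) (+-identityʳ _))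
        (suc m) → begin
          below (suc N) (suc m)  ≈⟨ chains-suc _ m ⟩
          ∑ _ (upTo (suc m))     ≈⟨ ∑-cong (term m) (upTo (suc m)) ⟩
          ∑ (λ k → (headed ok m k true + headed ok m k false) + top m k) (upTo (suc m))
                                 ≈⟨ ∑-+ _ _ (upTo (suc m)) ⟩
          ∑ _ (upTo (suc m)) + ∑ (top m) (upTo (suc m))
                                 ≈⟨ +-cong (sym (chains-suc _ m)) (∑-top m) ⟩
          atMost N (suc m) + x·U (suc m) ∎
      where
      ok : ℕ × Bool → Bool
      ok y = proj₁ y <ᵇ suc N

      term : ∀ m k → headed (pairOK (suc N , true)) m k true + headed (pairOK (suc N , true)) m k false
        ≈ (headed ok m k true + headed ok m k false) + top m k
      term m k with compareᵇ k N
      ... | less p q r       rewrite p | q = sym (+-identityʳ _)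
      ... | equal p ≡.refl r rewrite p | ≡ᵇ-refl k = +-congʳ (sym (+-identityˡ 0#))
      ... | greater p q r    rewrite p | q = sym (+-identityʳ _)

    -- With T, T⁺ for the two bounded series, eliminating U from T⁺ = T + 2xU and U = T + xU yields
    -- the factor (1 + x)/(1 - x), denominator cleared.
    atMost-ratio : (S.1# S.- monomial (w (suc N)) (suc N)) ⊛ atMost (suc N)
      ≋ (S.1# S.+ monomial (w (suc N)) (suc N)) ⊛ atMost N
    atMost-ratio = ratio {x = monomial (w (suc N)) (suc N)} atMost-suc below-suc
      where
      open CommutativeRingSolver seriesRing
      ratio : ∀ {x t t⁺ u} → t⁺ ≋ t S.+ (x ⊛ u S.+ x ⊛ u) → u ≋ t S.+ x ⊛ u →
        (S.1# S.- x) ⊛ t⁺ ≋ (S.1# S.+ x) ⊛ t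
      ratio {x} {t} {t⁺} {u} p q = S.trans (S.*-congˡ p) (S.trans
        (solve 3 (λ x t u → (:1 :- x) :* (t :+ (x :* u :+ x :* u)) :=
          (:1 :- x) :* t :+ (x :+ x) :* (u :- x :* u)) S.refl x t u)
        (S.trans (S.+-congˡ (S.*-congˡ (S.+-congʳ q)))
        (solve 3 (λ x t u → (:1 :- x) :* t :+ (x :+ x) :* ((t :+ x :* u) :- x :* u) :=
          (:1 :+ x) :* t) S.refl x t u)))

  -- The two flags of the first part double each new contribution. The half is kept as a witness,
  -- which gives a congruence mod 2 over any ring.
  atMost-≡1-mod-2 : ∀ N → ∃[ h ] atMost N ≋ S.1# S.+ (h S.+ h)
  atMost-≡1-mod-2 zero    = S.0# , S.trans atMost-0 (S.sym (S.trans (S.+-congˡ (S.+-identityˡ _)) (S.+-identityʳ _)))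
  atMost-≡1-mod-2 (suc N) with atMost-≡1-mod-2 N
  ... | h , eq = _ , S.trans (atMost-suc N) (S.trans (S.+-congʳ eq)
    (solve 2 (λ h y → (:1 :+ (h :+ h)) :+ (y :+ y) := :1 :+ ((h :+ y) :+ (h :+ y))) S.refl h _))
    where open CommutativeRingSolver seriesRing

square%3≢2 : ∀ c → ¬ (c ℕ.* c) % 3 ≡ 2
square%3≢2 c eq = residues (c % 3) (m%n<n c 3) (≡.trans (≡.sym (%-distribˡ-* c c 3)) eq)
  where
  residues : ∀ r → r < 3 → ¬ (r ℕ.* r) % 3 ≡ 2
  residues 0 _ ()
  residues 1 _ ()
  residues 2 _ ()
  residues (suc (suc (suc _))) (s≤s (s≤s (s≤s ())))

-- The generating function of overcubic partitions, weighted by u and v.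

module OvercubicSum {c ℓ : Level} (R : CommutativeRing c ℓ) (u v : CommutativeRing.Carrier R) where
  open CommutativeRing R
  open PowerSeries R
  open ListSum R
  open Algebra.Properties.CommutativeSemiring.Exp commutativeSemiring using (_^_)
  open Relation.Binary.Reasoning.Setoid setoid

  -- Odd red parts do not enter the crank and get weight 1; weight 0 forbids odd blue parts, so both
  -- colours are instances of one product formula.
  wʳ wᵇ : ℕ → Carrier
  wʳ c = if even c then u else 1#
  wᵇ c = if even c then v else 0#

  module Red  = Overpartitions R wʳ
  module Blue = Overpartitions R wᵇ

  private
    weightʳ : ∀ π → u ^ len (evenParts π) ≈ Red.weight π
    weightʳ []            = refl
    weightʳ ((c , _) ∷ π) with even c
    ... | true  = *-congˡ (weightʳ π)
    ... | false = trans (weightʳ π) (sym (*-identityˡ _))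

    weightᵇ : ∀ π → (if allEven π then v ^ len π else 0#) ≈ Blue.weight π
    weightᵇ []            = refl
    weightᵇ ((c , _) ∷ π) with even c
    ... | false = sym (zeroˡ _)
    ... | true  with allEven π | weightᵇ π
    ...   | true  | eq = *-congˡ eq
    ...   | false | eq = trans (sym (zeroʳ v)) (*-congˡ eq)

    red : ∀ {m N} → m ≤ N → ∑ (λ π → u ^ len (evenParts π)) (overpartitions m) ≈ Red.atMost N m
    red {m} m≤N = trans (∑-cong weightʳ (overpartitions m))
      (trans (Red.∑-overpartitions m) (Red.chains≈atMost m≤N))

    blue : ∀ {m N} → m ≤ N → ∑ (λ π → v ^ len π) (filterᵇ allEven (overpartitions m)) ≈ Blue.atMost N m
    blue {m} m≤N = trans (∑-filterᵇ _ allEven (overpartitions m)) (trans (∑-cong weightᵇ (overpartitions m))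
      (trans (Blue.∑-overpartitions m) (Blue.chains≈atMost m≤N)))

  -- For v inverse to u this is u to the power of the crank; for u = v = 1 it merely counts.
  crankWeight : FlaggedList × FlaggedList → Carrier
  crankWeight (πr , πb) = v ^ len πb * u ^ len (evenParts πr)

  ∑-overcubic : ∀ n → ∑ crankWeight (overcubic n) ≈ (Blue.atMost n ⊛ Red.atMost n) n
  ∑-overcubic n = begin
    ∑ crankWeight (overcubic n)
      ≈⟨ ∑-concatMap crankWeight pairs (upTo (suc n)) ⟩
    ∑ (λ j → ∑ crankWeight (pairs j)) (upTo (suc n))
      ≈⟨ ∑-cong product (upTo (suc n)) ⟩
    ∑ (λ j → blues j * reds (n ∸ j)) (upTo (suc n))
      ≈⟨ ∑-upTo-⊛ blues reds n ⟩
    (blues ⊛ reds) n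
      ≈⟨ ⊛-cong-≤ n (λ i → blue) (λ i → red) ⟩
    (Blue.atMost n ⊛ Red.atMost n) n ∎
    where
    blues reds : Series
    blues m = ∑ (λ π → v ^ len π) (filterᵇ allEven (overpartitions m))
    reds m  = ∑ (λ π → u ^ len (evenParts π)) (overpartitions m)

    withBlue : ℕ → FlaggedList → List (FlaggedList × FlaggedList)
    withBlue j πb = map (λ πr → (πr , πb)) (overpartitions (n ∸ j))

    pairs : ℕ → List (FlaggedList × FlaggedList)
    pairs j = concatMap (withBlue j) (filterᵇ allEven (overpartitions j))

    product : ∀ j → ∑ crankWeight (pairs j) ≈ blues j * reds (n ∸ j)
    product j = begin
      ∑ crankWeight (pairs j)
        ≈⟨ ∑-concatMap crankWeight (withBlue j) (filterᵇ allEven (overpartitions j)) ⟩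
      ∑ (λ πb → ∑ crankWeight (withBlue j πb)) (filterᵇ allEven (overpartitions j))
        ≈⟨ ∑-cong (λ πb → trans (reflexive (∑-map crankWeight (λ πr → (πr , πb)) (overpartitions (n ∸ j))))
             (∑-*ˡ (v ^ len πb) (λ πr → u ^ len (evenParts πr)) (overpartitions (n ∸ j))))
             (filterᵇ allEven (overpartitions j)) ⟩
      ∑ (λ πb → v ^ len πb * reds (n ∸ j)) (filterᵇ allEven (overpartitions j))
        ≈⟨ ∑-*ʳ (reds (n ∸ j)) (λ πb → v ^ len πb) (filterᵇ allEven (overpartitions j)) ⟩
      blues j * reds (n ∸ j) ∎

-- Factor identities at a primitive cube root of unity.

Cyclotomic₃ : ∀ {c ℓ} (R : CommutativeRing c ℓ) → CommutativeRing.Carrier R → Set ℓ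
Cyclotomic₃ R ω = 1# + ω + ω * ω ≈ 0#
  where open CommutativeRing R

module CubeRoot {c ℓ : Level} (S : CommutativeRing c ℓ) where
  open CommutativeRing S
  open CommutativeRingSolver S
  open Relation.Binary.Reasoning.Setoid setoid

  module _ {ω : Carrier} (1+ω+ω²≈0 : Cyclotomic₃ S ω) where
    cube-factors : ∀ x → (1# - ω * x) * (1# - ω * ω * x) * (1# - x) ≈ 1# - x * (x * x)
    cube-factors x = begin
      (1# - ω * x) * (1# - ω * ω * x) * (1# - x)
        -- The coefficients of x, x² and x³ differ from those of 1 - x³ by -1, ω and -(ω - 1) times
        -- 1 + ω + ω², the last because ω³ - 1 = (ω - 1)(1 + ω + ω²).
        ≈⟨ solve 2 (λ ω x →
             (:1 :- ω :* x) :* (:1 :- ω :* ω :* x) :* (:1 :- x) :=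
             :1 :- x :* (x :* x) :+ (:1 :+ ω :+ ω :* ω) :* (ω :* x :* x :- x :- (ω :- :1) :* x :* (x :* x))) refl ω x ⟩
      1# - x * (x * x) + (1# + ω + ω * ω) * (ω * x * x - x - (ω - 1#) * x * (x * x))
        ≈⟨ +-congˡ (trans (*-congʳ 1+ω+ω²≈0) (zeroˡ _)) ⟩
      1# - x * (x * x) + 0#
        ≈⟨ +-identityʳ _ ⟩
      1# - x * (x * x) ∎

    cube-factors⁺ : ∀ x → (1# + ω * x) * (1# + ω * ω * x) * (1# + x) ≈ 1# + x * (x * x)
    cube-factors⁺ x = begin
      (1# + ω * x) * (1# + ω * ω * x) * (1# + x)
        ≈⟨ solve 2 (λ ω x →
             (:1 :+ ω :* x) :* (:1 :+ ω :* ω :* x) :* (:1 :+ x) :=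
             (:1 :- ω :* (:- x)) :* (:1 :- ω :* ω :* (:- x)) :* (:1 :- (:- x))) refl ω x ⟩
      (1# - ω * (- x)) * (1# - ω * ω * (- x)) * (1# - (- x))
        ≈⟨ cube-factors (- x) ⟩
      1# - (- x) * ((- x) * (- x))
        ≈⟨ solve 1 (λ x → :1 :- (:- x) :* ((:- x) :* (:- x)) := :1 :+ x :* (x :* x)) refl x ⟩
      1# + x * (x * x) ∎

    -- The red and blue factors of an even part size multiply to (1 + x³)(1 - x) / ((1 - x³)(1 +
    -- x)), here cross-multiplied.
    even-factor : ∀ {x s s⁺ t t⁺} → (1# - ω * x) * s⁺ ≈ (1# + ω * x) * s →
      (1# - ω * ω * x) * t⁺ ≈ (1# + ω * ω * x) * t →
      (t⁺ * s⁺) * (1# - x * (x * x)) * (1# + x) ≈ (t * s) * (1# + x * (x * x)) * (1# - x)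
    even-factor {x} {s} {s⁺} {t} {t⁺} p q = begin
      (t⁺ * s⁺) * (1# - x * (x * x)) * (1# + x)
        ≈⟨ *-congʳ (*-congˡ (cube-factors x)) ⟨
      (t⁺ * s⁺) * ((1# - ω * x) * (1# - ω * ω * x) * (1# - x)) * (1# + x)
        ≈⟨ solve 5 (λ a b x s t → (t :* s) :* (a :* b :* (:1 :- x)) :* (:1 :+ x) :=
             (a :* s) :* (b :* t) :* ((:1 :- x) :* (:1 :+ x))) refl _ _ x s⁺ t⁺ ⟩
      ((1# - ω * x) * s⁺) * ((1# - ω * ω * x) * t⁺) * ((1# - x) * (1# + x))
        ≈⟨ *-congʳ (*-cong p q) ⟩
      ((1# + ω * x) * s) * ((1# + ω * ω * x) * t) * ((1# - x) * (1# + x))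
        ≈⟨ solve 5 (λ a b x s t → (a :* s) :* (b :* t) :* ((:1 :- x) :* (:1 :+ x)) :=
             (t :* s) :* (a :* b :* (:1 :+ x)) :* (:1 :- x)) refl _ _ x s t ⟩
      (t * s) * ((1# + ω * x) * (1# + ω * ω * x) * (1# + x)) * (1# - x)
        ≈⟨ *-congʳ (*-congˡ (cube-factors⁺ x)) ⟩
      (t * s) * (1# + x * (x * x)) * (1# - x) ∎

-- Vanishing of the crank series at exponents 2 mod 3.

module CrankVanishing {c ℓ : Level} (R : CommutativeRing c ℓ) (ω : CommutativeRing.Carrier R)
  (1+ω+ω²≈0 : Cyclotomic₃ R ω) where
  open CommutativeRing R using (1#; _*_) renaming (-_ to -ᴿ_; reflexive to R-reflexive)
  private module R = CommutativeRing R
  open PowerSeries R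
  open OvercubicSum R ω (ω * ω)
  open S using (_+_; _-_; -_; refl; sym; trans; *-cong; *-congˡ; *-congʳ; +-cong; +-congˡ; -‿cong)
  open CommutativeRingSolver seriesRing
  open Algebra.Properties.CommutativeSemiring.Exp S.commutativeSemiring using (_^_; ^-homo-*)
  open Algebra.Properties.Ring S.ring using (-1*x≈-x)
  open Relation.Binary.Reasoning.Setoid S.setoid

  p : Series
  p = - X

  open GaussIdentity seriesRing p

  p^-even : ∀ c → even c ≡ true → p ^ c ≋ X ^ c
  p^-even zero          _ = refl
  p^-even (suc (suc c)) e = trans (*-congˡ (*-congˡ (p^-even c e)))
    (solve 2 (λ x y → (:- x) :* ((:- x) :* y) := x :* (x :* y)) refl X (X ^ c))

  p^-odd : ∀ c → even c ≡ false → p ^ c ≋ - (X ^ c)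
  p^-odd (suc zero)    _ = solve 1 (λ x → (:- x) :* :1 := :- (x :* :1)) refl X
  p^-odd (suc (suc c)) e = trans (*-congˡ (*-congˡ (p^-odd c e)))
    (solve 2 (λ x y → (:- x) :* ((:- x) :* (:- y)) := :- (x :* (x :* y))) refl X (X ^ c))

  p^-isMonomial : ∀ c → IsMonomial c (p ^ c)
  p^-isMonomial c = ≡.subst (λ d → IsMonomial d (p ^ c)) (ℕ.*-identityˡ c)
    (^-isMonomial {1} c (neg-isMonomial {1} (1# , solve 1 (λ x → x := :1 :* (x :* :1)) refl X)))

  -- A factor of the series in q³, with a = 1 in the numerator and a = -1 in the denominator. Odd
  -- sizes produce no cubes.
  cubic : R.Carrier → ℕ → Series
  cubic a c = if even c then S.1# + monomial a (3 ℕ.* c) else S.1#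

  cubics : R.Carrier → ℕ → Series
  cubics a zero    = S.1#
  cubics a (suc n) = cubic a (suc n) ⊛ cubics a n

  G : ℕ → Series
  G n = Blue.atMost n ⊛ Red.atMost n

  private
    X^3* : ∀ c → X ^ (3 ℕ.* c) ≋ X ^ c ⊛ (X ^ c ⊛ X ^ c)
    X^3* c = trans (^-homo-* X c (c ℕ.+ (c ℕ.+ 0))) (*-congˡ (trans (^-homo-* X c (c ℕ.+ 0))
      (*-congˡ (trans (^-homo-* X c 0) (S.*-identityʳ _)))))

    monomial-1 : ∀ d → monomial 1# d ≋ X ^ d
    monomial-1 d = S.*-identityˡ _

    monomial-neg1 : ∀ d → monomial (-ᴿ 1#) d ≋ - (X ^ d)
    monomial-neg1 d = trans (*-congʳ (κ-neg 1#)) (-1*x≈-x _)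

    κω : Cyclotomic₃ seriesRing (κ ω)
    κω = begin
      S.1# + κ ω + κ ω ⊛ κ ω  ≈⟨ +-cong (κ-+ 1# ω) (κ-* ω ω) ⟨
      κ (1# R.+ ω) + κ (ω * ω)  ≈⟨ κ-+ _ _ ⟨
      κ (1# R.+ ω R.+ ω * ω)    ≈⟨ κ-cong 1+ω+ω²≈0 ⟩
      κ R.0#                    ≈⟨ κ-0 ⟩
      S.0#                      ∎

    substFactor : ∀ {x y t t⁺} → x ≋ y → (S.1# - x) ⊛ t⁺ ≋ (S.1# + x) ⊛ t → (S.1# - y) ⊛ t⁺ ≋ (S.1# + y) ⊛ t
    substFactor eq h = trans (*-congʳ (+-congˡ (-‿cong (sym eq)))) (trans h (*-congʳ (+-congˡ eq)))

  -- For even c the sign in p^c disappears and `even-factor` applies; for odd c the red factor (1 +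
  -- X^c)/(1 - X^c) already is (1 - p^c)/(1 + p^c).
  G-factor : ∀ n → G (suc n) ⊛ cubic (-ᴿ 1#) (suc n) ⊛ (S.1# + p ^ suc n)
    ≋ G n ⊛ cubic 1# (suc n) ⊛ (S.1# - p ^ suc n)
  G-factor n = by-parity (even (suc n)) ≡.refl
    where
    x = X ^ suc n

    -- Parity is abstracted in the cubic factors alone; the equation is kept to evaluate the weights
    -- inside `Red` and `Blue`.
    by-parity : ∀ b → even (suc n) ≡ b →
      G (suc n) ⊛ (if b then S.1# + monomial (-ᴿ 1#) (3 ℕ.* suc n) else S.1#) ⊛ (S.1# + p ^ suc n)
        ≋ G n ⊛ (if b then S.1# + monomial 1# (3 ℕ.* suc n) else S.1#) ⊛ (S.1# - p ^ suc n)
    by-parity true e = begin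
      G (suc n) ⊛ (S.1# + monomial (-ᴿ 1#) (3 ℕ.* suc n)) ⊛ (S.1# + p ^ suc n)
        ≈⟨ *-cong (*-congˡ (+-congˡ (trans (monomial-neg1 (3 ℕ.* suc n)) (-‿cong (X^3* (suc n))))))
             (+-congˡ (p^-even (suc n) e)) ⟩
      G (suc n) ⊛ (S.1# - x ⊛ (x ⊛ x)) ⊛ (S.1# + x)
        ≈⟨ CubeRoot.even-factor seriesRing κω
             (substFactor (*-congʳ (κ-cong (R-reflexive (≡.cong (λ b → if b then ω else 1#) e))))
               (Red.atMost-ratio n))
             (substFactor (*-congʳ (trans (κ-cong (R-reflexive (≡.cong (λ b → if b then ω * ω else R.0#) e))) (κ-* ω ω)))
               (Blue.atMost-ratio n)) ⟩
      G n ⊛ (S.1# + x ⊛ (x ⊛ x)) ⊛ (S.1# - x)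
        ≈⟨ *-cong (*-congˡ (+-congˡ (trans (monomial-1 (3 ℕ.* suc n)) (X^3* (suc n)))))
             (+-congˡ (-‿cong (p^-even (suc n) e))) ⟨
      G n ⊛ (S.1# + monomial 1# (3 ℕ.* suc n)) ⊛ (S.1# - p ^ suc n) ∎
    by-parity false e = begin
      Blue.atMost (suc n) ⊛ Red.atMost (suc n) ⊛ S.1# ⊛ (S.1# + p ^ suc n)
        ≈⟨ *-congˡ (+-congˡ (p^-odd (suc n) e)) ⟩
      Blue.atMost (suc n) ⊛ Red.atMost (suc n) ⊛ S.1# ⊛ (S.1# - x)
        -- Blue parts of odd size have weight 0, so the trivial factor is written 1 - 0 to fit
        -- `Blue.atMost-ratio`.
        ≈⟨ solve 3 (λ t s x → t :* s :* :1 :* (:1 :- x) := ((:1 :- :0) :* t) :* ((:1 :- x) :* s))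
             refl (Blue.atMost (suc n)) (Red.atMost (suc n)) x ⟩
      ((S.1# - S.0#) ⊛ Blue.atMost (suc n)) ⊛ ((S.1# - x) ⊛ Red.atMost (suc n))
        ≈⟨ *-cong
             (substFactor (trans (*-congʳ (trans (κ-cong (R-reflexive (≡.cong (λ b → if b then ω * ω else R.0#) e))) κ-0)) (S.zeroˡ x))
               (Blue.atMost-ratio n))
             (substFactor (trans (*-congʳ (κ-cong (R-reflexive (≡.cong (λ b → if b then ω else 1#) e)))) (monomial-1 (suc n)))
               (Red.atMost-ratio n)) ⟩
      ((S.1# + S.0#) ⊛ Blue.atMost n) ⊛ ((S.1# + x) ⊛ Red.atMost n)
        ≈⟨ solve 3 (λ t s x → ((:1 :+ :0) :* t) :* ((:1 :+ x) :* s) := t :* s :* :1 :* (:1 :- (:- x)))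
             refl (Blue.atMost n) (Red.atMost n) x ⟩
      Blue.atMost n ⊛ Red.atMost n ⊛ S.1# ⊛ (S.1# - (- x))
        ≈⟨ *-congˡ (+-congˡ (-‿cong (p^-odd (suc n) e))) ⟨
      Blue.atMost n ⊛ Red.atMost n ⊛ S.1# ⊛ (S.1# - p ^ suc n) ∎

  G-product : ∀ n → G n ⊛ cubics (-ᴿ 1#) n ⊛ poch⁺ n ≋ cubics 1# n ⊛ poch⁻ n
  G-product zero    = *-congʳ (trans (S.*-identityʳ _) (trans (*-cong Blue.atMost-0 Red.atMost-0) (S.*-identityˡ _)))
  G-product (suc n) = begin
    G (suc n) ⊛ (k ⊛ cubics (-ᴿ 1#) n) ⊛ ((S.1# + y) ⊛ poch⁺ n)
      ≈⟨ solve 5 (λ g k K y V → g :* (k :* K) :* (y :* V) := (g :* k :* y) :* (K :* V)) refl _ _ _ _ _ ⟩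
    (G (suc n) ⊛ k ⊛ (S.1# + y)) ⊛ (cubics (-ᴿ 1#) n ⊛ poch⁺ n)
      ≈⟨ *-congʳ (G-factor n) ⟩
    (G n ⊛ l ⊛ (S.1# - y)) ⊛ (cubics (-ᴿ 1#) n ⊛ poch⁺ n)
      ≈⟨ solve 5 (λ g l y K V → (g :* l :* y) :* (K :* V) := (l :* y) :* (g :* K :* V)) refl _ _ _ _ _ ⟩
    (l ⊛ (S.1# - y)) ⊛ (G n ⊛ cubics (-ᴿ 1#) n ⊛ poch⁺ n)
      ≈⟨ *-congˡ (G-product n) ⟩
    (l ⊛ (S.1# - y)) ⊛ (cubics 1# n ⊛ poch⁻ n)
      ≈⟨ solve 4 (λ l y L W → (l :* y) :* (L :* W) := (l :* L) :* (y :* W)) refl _ _ _ _ ⟩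
    (l ⊛ cubics 1# n) ⊛ ((S.1# - y) ⊛ poch⁻ n) ∎
    where
    k = cubic (-ᴿ 1#) (suc n)
    l = cubic 1# (suc n)
    y = p ^ suc n

  module _ {I : ℕ → Set} where
    -- The exponents of the factors 1 + p^c run through all c ≤ n, so closure under every shift is
    -- assumed: initial segments have it, a residue class mod 3 does not.
    vanishes-poch⁺-cancel : ∀ n {f} → (∀ d → ClosedUnder d I) → Vanishes I (poch⁺ n ⊛ f) → Vanishes I f
    vanishes-poch⁺-cancel zero    closed v = vanishes-≋ (S.*-identityˡ _) v
    vanishes-poch⁺-cancel (suc n) {f} closed v = vanishes-poch⁺-cancel n closed
      (vanishes-isMonomial-cancel {d = n} (p^-isMonomial (suc n)) (closed (suc n))
        (vanishes-≋ (S.*-assoc (S.1# + p ^ suc n) (poch⁺ n) f) v))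

    module _ (closed : ∀ c → ClosedUnder (3 ℕ.* c) I) where
      -- Shifts by multiples of 3 preserve residues mod 3, so here the set may be a residue class.
      vanishes-cubics-⊛ : ∀ a n {f} → Vanishes I f → Vanishes I (cubics a n ⊛ f)
      vanishes-cubics-⊛ a zero    v = vanishes-≋ (sym (S.*-identityˡ _)) v
      vanishes-cubics-⊛ a (suc n) {f} v = vanishes-≋ (sym (S.*-assoc _ _ _)) (one-factor (vanishes-cubics-⊛ a n v))
        where
        one-factor : ∀ {g} → Vanishes I g → Vanishes I (cubic a (suc n) ⊛ g)
        one-factor v with even (suc n)
        ... | false = vanishes-≋ (sym (S.*-identityˡ _)) v
        ... | true  = vanishes-≋ (sym (S.distribʳ _ _ _)) (vanishes-+ (vanishes-≋ (sym (S.*-identityˡ _)) v)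
                        (vanishes-monomial-⊛ a (3 ℕ.* suc n) (closed (suc n)) v))

      vanishes-cubics-cancel : ∀ a n {f} → Vanishes I (cubics a n ⊛ f) → Vanishes I f
      vanishes-cubics-cancel a zero    v = vanishes-≋ (S.*-identityˡ _) v
      vanishes-cubics-cancel a (suc n) {f} v =
        vanishes-cubics-cancel a n (one-factor (vanishes-≋ (S.*-assoc _ _ _) v))
        where
        one-factor : ∀ {g} → Vanishes I (cubic a (suc n) ⊛ g) → Vanishes I g
        one-factor v with even (suc n)
        ... | false = vanishes-≋ (S.*-identityˡ _) v
        ... | true  = vanishes-cancel a _ (closed (suc n)) v

  θ-vanishes : ∀ {I : ℕ → Set} → (∀ m → I m → m % 3 ≡ 2) → ∀ n → Vanishes I (θ n)
  θ-vanishes         h zero    zero    i with () ← h 0 i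
  θ-vanishes         h zero    (suc m) i = R.refl
  θ-vanishes {I = I} h (suc n) = vanishes-+ {f = θ n} (θ-vanishes h n)
    (vanishes-≋ (solve 1 (λ y → y :+ y := (:1 :+ :1) :* y) refl y) (vanishes-+ {f = y} {g = y} square square))
    where
    y : Series
    y = (- (p ^ suc n)) ^ suc n

    square : Vanishes I y
    square = vanishes-isMonomial {d = suc n ℕ.* suc n}
      (^-isMonomial {suc n} (suc n) (neg-isMonomial {suc n} (p^-isMonomial (suc n))))
      (λ i → square%3≢2 (suc n) (h (suc n ℕ.* suc n) i))

  -- K G = L θ + D, where L θ vanishes at exponents 2 mod 3 and D at all exponents up to n. On the
  -- intersection `I` the product K G vanishes, and K, a series in q³, cancels.
  G-vanishes : ∀ n → n % 3 ≡ 2 → G n n R.≈ R.0#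
  G-vanishes n n%3≡2 = vanishes-cubics-cancel closed (-ᴿ 1#) n
    (vanishes-≋ split (vanishes-+ (vanishes-cubics-⊛ closed 1# n (θ-vanishes (λ _ → proj₂) n))
      (λ m (m≤n , _) → D-vanishes m m≤n))) n (ℕ.≤-refl , n%3≡2)
    where
    I : ℕ → Set
    I m = m ≤ n × m % 3 ≡ 2

    closed : ∀ c → ClosedUnder (3 ℕ.* c) I
    closed c m (le , eq) = ℕ.m+n≤o⇒n≤o (3 ℕ.* c) le , ≡.trans (≡.sym residue) eq
      where
      residue : (3 ℕ.* c ℕ.+ m) % 3 ≡ m % 3
      residue = ≡.trans (≡.cong (_% 3) (≡.trans (ℕ.+-comm (3 ℕ.* c) m) (≡.cong (m ℕ.+_) (ℕ.*-comm 3 c))))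
        ([m+kn]%n≡m%n m c 3)

    K = cubics (-ᴿ 1#) n
    L = cubics 1# n
    D = G n ⊛ K - L ⊛ θ n

    split : L ⊛ θ n + D ≋ K ⊛ G n
    split = solve 4 (λ L t g K → L :* t :+ (g :* K :- L :* t) := K :* g) refl L (θ n) (G n) K

    D-vanishes : Vanishes (_≤ n) D
    D-vanishes = vanishes-poch⁺-cancel n (λ d m → ℕ.m+n≤o⇒n≤o d)
      (vanishes-≋ (sym remainder)
        (vanishes-isMonomial-⊛ (- (L ⊛ b)) (p^-isMonomial (suc n)) (λ _ → s≤s)))
      where
      b V W : Series
      b = proj₁ (gauss n)
      V = poch⁺ n
      W = poch⁻ n

      -- Multiplying by (-p;p)_n turns both terms of D into L (p;p)_n up to the error in Gauss's
      -- identity, which is divisible by p^{n+1}.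
      remainder : V ⊛ D ≋ p ^ suc n ⊛ (- (L ⊛ b))
      remainder = begin
        V ⊛ (G n ⊛ K - L ⊛ θ n)
          ≈⟨ solve 5 (λ V g K L t → V :* (g :* K :- L :* t) := g :* K :* V :- L :* (t :* V)) refl V (G n) K L (θ n) ⟩
        G n ⊛ K ⊛ V - L ⊛ (θ n ⊛ V)
          ≈⟨ +-cong (G-product n) (-‿cong (*-congˡ (proj₂ (gauss n)))) ⟩
        L ⊛ W - L ⊛ (W + p ^ suc n ⊛ b)
          ≈⟨ solve 4 (λ L W z b → L :* W :- L :* (W :+ z :* b) := z :* (:- (L :* b))) refl L W (p ^ suc n) b ⟩
        p ^ suc n ⊛ (- (L ⊛ b)) ∎

  ∑-crankWeight-vanishes : ∀ n → n % 3 ≡ 2 → ListSum.∑ R crankWeight (overcubic n) R.≈ R.0#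
  ∑-crankWeight-vanishes n n%3≡2 = R.trans (∑-overcubic n) (G-vanishes n n%3≡2)

-- Eisenstein integers and powers of ω.

open import Data.Integer as ℤ using (ℤ; +_; -[1+_]; _⊖_; _%ℕ_)
open import Data.Integer.DivMod using (n%ℕd<d)
open import Data.Integer.Solver using (module +-*-Solver)
import Data.Integer.Properties as ℤ

-- (a , b) is a + b ω with ω² = - 1 - ω.
eisenstein : CommutativeRing 0ℓ 0ℓ
eisenstein = record
  { Carrier = ℤ × ℤ
  ; _≈_ = _≡_
  ; _+_ = λ (a , b) (c , d) → a ℤ.+ c , b ℤ.+ d
  ; _*_ = λ (a , b) (c , d) → a ℤ.* c ℤ.- b ℤ.* d , a ℤ.* d ℤ.+ b ℤ.* c ℤ.- b ℤ.* d
  ; -_  = λ (a , b) → ℤ.- a , ℤ.- b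
  ; 0#  = + 0 , + 0
  ; 1#  = + 1 , + 0
  ; isCommutativeRing = record
    { isRing = record
      { +-isAbelianGroup = record
        { isGroup = record
          { isMonoid = record
            { isSemigroup = record
              { isMagma = record { isEquivalence = ≡.isEquivalence ; ∙-cong = ≡.cong₂ _ }
              ; assoc = λ (a , b) (c , d) (e , f) → ≡.cong₂ _,_ (ℤ.+-assoc a c e) (ℤ.+-assoc b d f)
              }
            ; identity = (λ (a , b) → ≡.cong₂ _,_ (ℤ.+-identityˡ a) (ℤ.+-identityˡ b))
                       , (λ (a , b) → ≡.cong₂ _,_ (ℤ.+-identityʳ a) (ℤ.+-identityʳ b))
            }
          ; inverse = (λ (a , b) → ≡.cong₂ _,_ (ℤ.+-inverseˡ a) (ℤ.+-inverseˡ b))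
                    , (λ (a , b) → ≡.cong₂ _,_ (ℤ.+-inverseʳ a) (ℤ.+-inverseʳ b))
          ; ⁻¹-cong = λ { ≡.refl → ≡.refl }
          }
        ; comm = λ (a , b) (c , d) → ≡.cong₂ _,_ (ℤ.+-comm a c) (ℤ.+-comm b d)
        }
      ; *-cong = ≡.cong₂ _
      ; *-assoc = λ (a , b) (c , d) (e , f) → ≡.cong₂ _,_
          (solve 6 (λ a b c d e f →
            (a :* c :- b :* d) :* e :- (a :* d :+ b :* c :- b :* d) :* f :=
            a :* (c :* e :- d :* f) :- b :* (c :* f :+ d :* e :- d :* f)) ≡.refl a b c d e f)
          (solve 6 (λ a b c d e f →
            (a :* c :- b :* d) :* f :+ (a :* d :+ b :* c :- b :* d) :* e :- (a :* d :+ b :* c :- b :* d) :* f :=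
            a :* (c :* f :+ d :* e :- d :* f) :+ b :* (c :* e :- d :* f) :- b :* (c :* f :+ d :* e :- d :* f))
            ≡.refl a b c d e f)
      ; *-identity = (λ (a , b) → ≡.cong₂ _,_
          (solve 2 (λ a b → con (+ 1) :* a :- con (+ 0) :* b := a) ≡.refl a b)
          (solve 2 (λ a b → con (+ 1) :* b :+ con (+ 0) :* a :- con (+ 0) :* b := b) ≡.refl a b))
        , (λ (a , b) → ≡.cong₂ _,_
          (solve 2 (λ a b → a :* con (+ 1) :- b :* con (+ 0) := a) ≡.refl a b)
          (solve 2 (λ a b → a :* con (+ 0) :+ b :* con (+ 1) :- b :* con (+ 0) := b) ≡.refl a b))
      ; distrib = (λ (a , b) (c , d) (e , f) → ≡.cong₂ _,_
          (solve 6 (λ a b c d e f → a :* (c :+ e) :- b :* (d :+ f) :=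
            (a :* c :- b :* d) :+ (a :* e :- b :* f)) ≡.refl a b c d e f)
          (solve 6 (λ a b c d e f → a :* (d :+ f) :+ b :* (c :+ e) :- b :* (d :+ f) :=
            (a :* d :+ b :* c :- b :* d) :+ (a :* f :+ b :* e :- b :* f)) ≡.refl a b c d e f))
        , (λ (a , b) (c , d) (e , f) → ≡.cong₂ _,_
          (solve 6 (λ a b c d e f → (c :+ e) :* a :- (d :+ f) :* b :=
            (c :* a :- d :* b) :+ (e :* a :- f :* b)) ≡.refl a b c d e f)
          (solve 6 (λ a b c d e f → (c :+ e) :* b :+ (d :+ f) :* a :- (d :+ f) :* b :=
            (c :* b :+ d :* a :- d :* b) :+ (e :* b :+ f :* a :- f :* b)) ≡.refl a b c d e f))
      }
    ; *-comm = λ (a , b) (c , d) → ≡.cong₂ _,_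
        (solve 4 (λ a b c d → a :* c :- b :* d := c :* a :- d :* b) ≡.refl a b c d)
        (solve 4 (λ a b c d → a :* d :+ b :* c :- b :* d := c :* b :+ d :* a :- d :* b) ≡.refl a b c d)
    }
  }
  where open +-*-Solver

module E = CommutativeRing eisenstein
open Algebra.Properties.CommutativeSemiring.Exp E.commutativeSemiring using () renaming (_^_ to _^ᴱ_)

ω ω² : ℤ × ℤ
ω  = + 0 , + 1
ω² = ω E.* ω

-- Applied to residues mod 3 throughout, so the last clause stands for 2.
ω^[_] : ℕ → ℤ × ℤ
ω^[ 0 ] = E.1#
ω^[ 1 ] = ω
ω^[ _ ] = ω²

cube-cancel : ∀ x → x E.* (x E.* x) ≡ E.1# → ∀ y → x E.* (x E.* (x E.* y)) ≡ y
cube-cancel x x³≡1 y = begin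
  x E.* (x E.* (x E.* y))    ≡⟨ ≡.cong (x E.*_) (E.*-assoc x x y) ⟨
  x E.* ((x E.* x) E.* y)    ≡⟨ E.*-assoc x (x E.* x) y ⟨
  (x E.* (x E.* x)) E.* y    ≡⟨ ≡.cong (E._* y) x³≡1 ⟩
  E.1# E.* y                 ≡⟨ E.*-identityˡ y ⟩
  y                          ∎
  where open ≡.≡-Reasoning

ω^-residue : ∀ a → ω ^ᴱ a ≡ ω^[ a % 3 ]
ω^-residue 0                   = ≡.refl
ω^-residue 1                   = ≡.refl
ω^-residue 2                   = ≡.refl
ω^-residue (suc (suc (suc a))) = ≡.trans (cube-cancel ω ≡.refl (ω ^ᴱ a)) (ω^-residue a)

ω²^-residue : ∀ b → ω² ^ᴱ suc b ≡ ω^[ -[1+ b ] %ℕ 3 ]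
ω²^-residue 0                   = ≡.refl
ω²^-residue 1                   = ≡.refl
ω²^-residue 2                   = ≡.refl
ω²^-residue (suc (suc (suc b))) = ≡.trans (cube-cancel ω² ≡.refl (ω² ^ᴱ suc b)) (ω²^-residue b)

-- Since ω² is inverse to ω, one factor of each cancels, just as `⊖` strips a successor from both
-- sides, until one exponent is zero.
ω²^*ω^ : ∀ a b → ω² ^ᴱ b E.* ω ^ᴱ a ≡ ω^[ (a ⊖ b) %ℕ 3 ]
ω²^*ω^ a       zero    = ≡.trans (E.*-identityˡ (ω ^ᴱ a)) (ω^-residue a)
ω²^*ω^ zero    (suc b) = ≡.trans (E.*-identityʳ (ω² ^ᴱ suc b)) (ω²^-residue b)
ω²^*ω^ (suc a) (suc b) = begin
  (ω² E.* y) E.* (ω E.* x)  ≡⟨ regroup ω² y ω x ⟩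
  -- `ω² E.* ω` evaluates to `E.1#`.
  (ω² E.* ω) E.* (y E.* x)  ≡⟨ E.*-identityˡ (y E.* x) ⟩
  y E.* x                   ≡⟨ ω²^*ω^ a b ⟩
  ω^[ (a ⊖ b) %ℕ 3 ]        ≡⟨ ≡.cong (λ i → ω^[ i %ℕ 3 ]) (ℤ.[1+m]⊖[1+n]≡m⊖n a b) ⟨
  ω^[ (suc a ⊖ suc b) %ℕ 3 ] ∎
  where
  open ≡.≡-Reasoning
  x = ω ^ᴱ a
  y = ω² ^ᴱ b
  regroup : ∀ p q r s → (p E.* q) E.* (r E.* s) ≡ (p E.* r) E.* (q E.* s)
  regroup = solve 4 (λ p q r s → (p :* q) :* (r :* s) := (p :* r) :* (q :* s)) ≡.refl
    where open CommutativeRingSolver eisenstein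

-- From a vanishing sum of roots of unity to equal counts.

open import Data.Nat using (_+_; _*_; _/_)

module _ {A : Set} (r : A → ℕ) (r<3 : ∀ x → r x < 3) where
  private
    count : ℕ → List A → ℕ
    count i xs = length (filterᵇ (λ x → r x ≡ᵇ i) xs)

  open ListSum eisenstein
  open +-*-Solver

  -- As ω² = -1 - ω, residue 2 is subtracted from both coordinates. A zero sum thus makes all three
  -- counts equal.
  ∑-ω^[] : ∀ xs → ∑ (λ x → ω^[ r x ]) xs ≡ (+ count 0 xs ℤ.- + count 2 xs , + count 1 xs ℤ.- + count 2 xs)
  ∑-ω^[] []       = ≡.refl
  ∑-ω^[] (x ∷ xs) with r x | r<3 x
  ... | 0 | _ = ≡.trans (≡.cong (E.1# E.+_) (∑-ω^[] xs)) (≡.cong₂ _,_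
    (solve 2 (λ a c → con (+ 1) :+ (a :- c) := (con (+ 1) :+ a) :- c) ≡.refl (+ count 0 xs) (+ count 2 xs))
    (ℤ.+-identityˡ _))
  ... | 1 | _ = ≡.trans (≡.cong (ω E.+_) (∑-ω^[] xs)) (≡.cong₂ _,_
    (ℤ.+-identityˡ _)
    (solve 2 (λ a c → con (+ 1) :+ (a :- c) := (con (+ 1) :+ a) :- c) ≡.refl (+ count 1 xs) (+ count 2 xs)))
  ... | 2 | _ = ≡.trans (≡.cong (ω² E.+_) (∑-ω^[] xs)) (≡.cong₂ _,_
    (solve 2 (λ a c → con -[1+ 0 ] :+ (a :- c) := a :- (con (+ 1) :+ c)) ≡.refl (+ count 0 xs) (+ count 2 xs))
    (solve 2 (λ a c → con -[1+ 0 ] :+ (a :- c) := a :- (con (+ 1) :+ c)) ≡.refl (+ count 1 xs) (+ count 2 xs)))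
  ... | suc (suc (suc _)) | s≤s (s≤s (s≤s ()))

  length-residues : ∀ xs → length xs ≡ count 0 xs + (count 1 xs + count 2 xs)
  length-residues []       = ≡.refl
  length-residues (x ∷ xs) with r x | r<3 x
  ... | 0 | _ = ≡.cong suc (length-residues xs)
  ... | 1 | _ = ≡.trans (≡.cong suc (length-residues xs)) (≡.sym (ℕ.+-suc (count 0 xs) _))
  ... | 2 | _ = ≡.trans (≡.cong suc (length-residues xs)) (≡.sym (≡.trans
    (≡.cong (ℕ._+_ (count 0 xs)) (ℕ.+-suc (count 1 xs) _)) (ℕ.+-suc (count 0 xs) _)))
  ... | suc (suc (suc _)) | s≤s (s≤s (s≤s ()))

crankResidue : FlaggedList × FlaggedList → ℕ
crankResidue π = crank π %ℕ 3

crankResidue<3 : ∀ π → crankResidue π < 3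
crankResidue<3 π = n%ℕd<d (crank π) 3

equidistribution : ∀ n → n % 3 ≡ 2 → Cbar 0 2 n ≡ Cbar 2 2 n × Cbar 1 2 n ≡ Cbar 2 2 n
equidistribution n n%3≡2 = zero-difference (≡.cong proj₁ differences≡0) , zero-difference (≡.cong proj₂ differences≡0)
  where
  open CrankVanishing eisenstein ω ≡.refl using (∑-crankWeight-vanishes)
  open OvercubicSum eisenstein ω ω² using (crankWeight)
  open ListSum eisenstein

  crankWeight≡ : ∀ π → crankWeight π ≡ ω^[ crankResidue π ]
  crankWeight≡ (πr , πb) = ≡.trans (ω²^*ω^ (len (evenParts πr)) (len πb))
    (≡.cong (λ i → ω^[ i %ℕ 3 ]) (≡.sym (ℤ.m-n≡m⊖n (len (evenParts πr)) (len πb))))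

  differences≡0 : (+ Cbar 0 2 n ℤ.- + Cbar 2 2 n , + Cbar 1 2 n ℤ.- + Cbar 2 2 n) ≡ E.0#
  differences≡0 = begin
    (+ Cbar 0 2 n ℤ.- + Cbar 2 2 n , + Cbar 1 2 n ℤ.- + Cbar 2 2 n)
      ≡⟨ ∑-ω^[] crankResidue crankResidue<3 (overcubic n) ⟨
    ∑ (λ π → ω^[ crankResidue π ]) (overcubic n)
      ≡⟨ ∑-cong crankWeight≡ (overcubic n) ⟨
    ∑ crankWeight (overcubic n)
      ≡⟨ ∑-crankWeight-vanishes n n%3≡2 ⟩
    E.0# ∎
    where open ≡.≡-Reasoning

  zero-difference : ∀ {a b} → + a ℤ.- + b ≡ + 0 → a ≡ b
  zero-difference {a} {b} eq = ℤ.+-injective (ℤ.i-j≡0⇒i≡j (+ a) (+ b) eq)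

-- Parity of the number of overcubic partitions.

abar-even : ∀ n → 2 ∣ abar (suc n)
-- The half g is found as an integer coefficient; its absolute value is the natural quotient. The
-- index is positive because the constant coefficient is 1.
abar-even n = divides ℤ.∣ g ∣ (begin
  abar (suc n)            ≡⟨⟩
  ℤ.∣ + abar (suc n) ∣    ≡⟨ ≡.cong ℤ.∣_∣ doubled ⟩
  ℤ.∣ g ℤ.* + 2 ∣         ≡⟨ ℤ.abs-* g (+ 2) ⟩
  ℤ.∣ g ∣ * 2             ∎)
  where
  open ≡.≡-Reasoning
  open PowerSeries ℤ.+-*-commutativeRing
  open ListSum ℤ.+-*-commutativeRing
  open OvercubicSum ℤ.+-*-commutativeRing (+ 1) (+ 1)
  open Algebra.Properties.CommutativeSemiring.Exp ℤ.+-*-commutativeSemiring using (_^_)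

  1^ : ∀ k → (+ 1) ^ k ≡ + 1
  1^ zero    = ≡.refl
  1^ (suc k) = ≡.trans (ℤ.*-identityˡ _) (1^ k)

  ∑-1 : ∀ {A : Set} (xs : List A) → ∑ (λ _ → + 1) xs ≡ + length xs
  ∑-1 []       = ≡.refl
  ∑-1 (x ∷ xs) = ≡.cong (ℤ._+_ (+ 1)) (∑-1 xs)

  b = proj₁ (Blue.atMost-≡1-mod-2 (suc n))
  r = proj₁ (Red.atMost-≡1-mod-2 (suc n))
  -- Half of (1 + 2b)(1 + 2r) - 1.
  h = b S.+ r S.+ (b S.+ b) ⊛ r
  g = h (suc n)

  product : Blue.atMost (suc n) ⊛ Red.atMost (suc n) ≋ S.1# S.+ (h S.+ h)
  product = S.trans (S.*-cong (proj₂ (Blue.atMost-≡1-mod-2 (suc n))) (proj₂ (Red.atMost-≡1-mod-2 (suc n))))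
    (solve 2 (λ b r → (:1 :+ (b :+ b)) :* (:1 :+ (r :+ r)) :=
      :1 :+ ((b :+ r :+ (b :+ b) :* r) :+ (b :+ r :+ (b :+ b) :* r))) S.refl b r)
    where open CommutativeRingSolver seriesRing

  doubled : + abar (suc n) ≡ g ℤ.* + 2
  doubled = begin
    + length (overcubic (suc n))
      ≡⟨ ∑-1 (overcubic (suc n)) ⟨
    ∑ (λ _ → + 1) (overcubic (suc n))
      ≡⟨ ∑-cong (λ (πr , πb) → ≡.cong₂ ℤ._*_ (1^ (len πb)) (1^ (len (evenParts πr)))) (overcubic (suc n)) ⟨
    ∑ crankWeight (overcubic (suc n))
      ≡⟨ ∑-overcubic (suc n) ⟩
    (Blue.atMost (suc n) ⊛ Red.atMost (suc n)) (suc n)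
      ≡⟨ at product (suc n) ⟩
    + 0 ℤ.+ (g ℤ.+ g)
      ≡⟨ +-*-Solver.solve 1 (λ g → con (+ 0) :+ (g :+ g) := g :* con (+ 2)) ≡.refl g ⟩
    g ℤ.* + 2 ∎
    where open +-*-Solver using (con; _:+_; _:*_; _:=_)

theorem3p2 : (n : ℕ) →
    (Cbar 0 2 (3 * n + 2) ≡ Cbar 1 2 (3 * n + 2))
    × (Cbar 1 2 (3 * n + 2) ≡ Cbar 2 2 (3 * n + 2))
    × (3 ∣ abar (3 * n + 2))
    × (Cbar 2 2 (3 * n + 2) ≡ abar (3 * n + 2) / 3)
    × (2 ∣ abar (3 * n + 2) / 3)
theorem3p2 n =
    ≡.trans C₀≡C₂ (≡.sym C₁≡C₂)
  , C₁≡C₂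
  , divides C₂ abar≡
  , ≡.sym abar/3≡
  , ≡.subst (2 ∣_) (≡.sym abar/3≡) C₂-even
  where
  N = 3 * n + 2
  C₂ = Cbar 2 2 N

  N%3≡2 : N % 3 ≡ 2
  N%3≡2 = ≡.trans (≡.cong (_% 3) (≡.trans (ℕ.+-comm (3 * n) 2) (≡.cong (ℕ._+_ 2) (ℕ.*-comm 3 n)))) ([m+kn]%n≡m%n 2 n 3)

  C₀≡C₂ : Cbar 0 2 N ≡ C₂
  C₀≡C₂ = proj₁ (equidistribution N N%3≡2)

  C₁≡C₂ : Cbar 1 2 N ≡ C₂
  C₁≡C₂ = proj₂ (equidistribution N N%3≡2)

  abar≡ : abar N ≡ C₂ * 3
  abar≡ = begin
    abar N                               ≡⟨ length-residues crankResidue crankResidue<3 (overcubic N) ⟩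
    Cbar 0 2 N + (Cbar 1 2 N + C₂)       ≡⟨ ≡.cong₂ (λ a b → a + (b + C₂)) C₀≡C₂ C₁≡C₂ ⟩
    C₂ + (C₂ + C₂)                       ≡⟨ ≡.cong (λ a → C₂ + (C₂ + a)) (ℕ.+-identityʳ C₂) ⟨
    3 * C₂                               ≡⟨ ℕ.*-comm 3 C₂ ⟩
    C₂ * 3                               ∎
    where open ≡.≡-Reasoning

  abar/3≡ : abar N / 3 ≡ C₂
  abar/3≡ = ≡.trans (≡.cong (_/ 3) abar≡) (m*n/n≡m C₂ 3)

  abar-N-even : 2 ∣ abar N
  abar-N-even = ≡.subst (λ m → 2 ∣ abar m) (ℕ.+-comm 2 (3 * n)) (abar-even (suc (3 * n)))

  C₂-even : 2 ∣ C₂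
  -- The total 3 C₂ and the summand 2 C₂ are both even, so the remaining C₂ is.
  C₂-even = ∣m+n∣m⇒∣n (≡.subst (2 ∣_) (≡.trans abar≡ split) abar-N-even) (divides C₂ ≡.refl)
    where
    split : C₂ * 3 ≡ C₂ * 2 + C₂
    split = ≡.trans (ℕ.*-suc C₂ 2) (ℕ.+-comm C₂ (C₂ * 2))
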